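{- For integers $b\ge2$ and $n\ge1$, the number of juggling card sequences $A$ with $b$ balls, using $n$ cards from $\{C_1,\dots,C_b\}$ at least one of which is $C_b$, having $\pi_A=\mathrm{id}$ and $Cr(A)=b(b-1)+2$, is \[ g(b,n)=\binom{n}{b+2}\binom{n}{b-2}. \]
   Context: There are $b$ balls on levels $1,\dots,b$. For $1\le i\le b$ the card $C_i$ induces the permutation $\pi_{C_i}$ of $[b]$ with $\pi_{C_i}(1)=i$, $\pi_{C_i}(j)=j-1$ for $2\le j\le i$, $\pi_{C_i}(j)=j$ for $j>i$. For a juggling card sequence $A=C_{i_1}\cdots C_{i_n}$, $\pi_A=\pi_{C_{i_n}}\circ\cdots\circ\pi_{C_{i_1}}$ (the ball starting at level $j$ ends at level $\pi_A(j)$), and the number of crossings is $Cr(A)=\sum_{k=1}^n(i_k-1)$. -}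

module Defs where

open import Data.Nat using (ℕ; zero; suc; _+_; _≤?_)
open import Data.Fin using (Fin; zero; suc; toℕ; inject₁)
open import Data.Fin.Properties using (all?; _≟_)
open import Data.List using (List; []; _∷_; map; concatMap; length; filter)
open import Data.Nat.ListAction using (sum)
open import Data.List.Relation.Unary.Any using (Any)
open import Data.List.Relation.Unary.Any.Properties using ()
import Data.List.Relation.Unary.Any as Any
open import Data.Product using (_×_)
open import Relation.Binary.PropositionalEquality using (_≡_)
open import Relation.Nullary using (Dec; yes; no)
open import Relation.Nullary.Decidable using (_×-dec_)
import Data.Nat as ℕ
import Data.List as L

-- Levels 1..b are represented by Fin b (level k ↦ k-1); the card C_i by
-- the element i-1 of Fin b.  With 0-based i and levels, the permutation of
-- card i is: 0 ↦ i ; j ↦ j-1 for 1 ≤ j ≤ i ; j ↦ j for j > i.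
cardPerm : {b : ℕ} → Fin b → Fin b → Fin b
cardPerm i zero = i
cardPerm i (suc j) with toℕ (suc j) ≤? toℕ i
... | yes _ = inject₁ j
... | no  _ = suc j

perm : {b : ℕ} → List (Fin b) → Fin b → Fin b
perm []       j = j
perm (c ∷ cs) j = perm cs (cardPerm c j)

-- Cr(A) = Σ (i_k - 1); with 0-based cards this is Σ toℕ.
Cr : {b : ℕ} → List (Fin b) → ℕ
Cr A = sum (map toℕ A)

seqs : (b n : ℕ) → List (List (Fin b))
seqs b zero    = [] ∷ []
seqs b (suc n) = concatMap (λ c → map (c ∷_) (seqs b n)) (Data.List.allFin b)
  where import Data.List

IsId : {b : ℕ} → List (Fin b) → Set
IsId {b} A = ∀ (j : Fin b) → perm A j ≡ j

UsesTop : {b : ℕ} → List (Fin b) → Set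
UsesTop {b} A = Any (λ c → suc (toℕ c) ≡ b) A

Good : (b : ℕ) → List (Fin b) → Set
Good b A = IsId A × (UsesTop A × Cr A ≡ b ℕ.* (b ℕ.∸ 1) + 2)

good? : (b : ℕ) → (A : List (Fin b)) → Dec (Good b A)
good? b A =
  all? (λ j → perm A j ≟ j)
  ×-dec (Any.any? (λ c → suc (toℕ c) ℕ.≟ b) A
  ×-dec (Cr A ℕ.≟ b ℕ.* (b ℕ.∸ 1) + 2))

g : ℕ → ℕ → ℕ
g b n = length (filter (good? b) (seqs b n))

{-# OPTIONS --safe #-}
module Submission where

-- Record the balls thrown by a card sequence as a word.  If π_A = id and C_b is used, the word is an
-- arbitrary restricted growth word in all b letters, and Cr counts, over unordered pairs of letters,
-- the changes in the cyclic restriction of the word to the pair.  Every pair contributes at least 2,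
-- so Cr = b(b − 1) + 2 · excess, where the excess counts the pairs of an occurrence of a letter z, not
-- the first one, and a letter u < z occurring since the previous occurrence of z.
--
-- Words of excess 1 are counted by reading them from the left.  Order the letters seen so far by
-- their last occurrence; reading a letter z adds to the excess the number of smaller letters that are
-- more recent than z.  Hence only records (no such smaller letter) and, once, an almost-record (exactly
-- one) may be read.  The number of completions depends only on the number of records and of
-- almost-records, and is linear in the latter because a sum over the stack of records telescopes.

open import Defs
open import Data.Bool using (Bool; true; false; if_then_else_; _∧_; T)
open import Data.Bool.Properties using (∧-zeroʳ)
open import Data.Fin using (Fin; zero; suc; toℕ; fromℕ; fromℕ<; inject₁; punchIn)
open import Data.Fin.Properties using
  (_≟_; toℕ-fromℕ; toℕ-fromℕ<; toℕ-injective; toℕ<n; toℕ≤pred[n];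
   punchIn-injective; punchInᵢ≢i; punchIn-mono-≤; punchIn-cancel-≤)
open import Data.List using (List; []; _∷_; _∷ʳ_; length; filter; map; concatMap; tabulate)
open import Data.List.Properties using (filter-++; length-++)
open import Data.List.Relation.Unary.Any as Any using (here; there)
open import Data.Nat hiding (_≟_)
open import Data.Nat using () renaming (_≟_ to _≟ℕ_)
open import Data.Nat.Combinatorics using (_C_; nCk+nC[k+1]≡[n+1]C[k+1])
open import Data.Nat.Properties hiding (_≟_)
open import Data.Nat.Tactic.RingSolver using (solve-∀)
open import Data.Product using (_×_; _,_; proj₁; proj₂)
open import Data.Sum using (inj₁; inj₂)
open import Data.Unit using (⊤; tt)
open import Data.Empty using (⊥-elim)
open import Function using (_∘_)
open import Relation.Binary.Definitions using (tri<; tri≈; tri>)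
open import Relation.Binary.PropositionalEquality
open import Relation.Nullary using (¬_; Dec; yes; no; does; contradiction)
open import Relation.Nullary.Decidable using (dec-true; dec-false)
open import Relation.Unary using (Decidable)
open import Algebra.Properties.Semiring.Sum +-*-semiring using
  (sum; sum-cong-≗; ∑-distrib-+; ∑-comm; sum-replicate-zero; sum-remove; *-distribˡ-sum)
open ≡-Reasoning

-- Binomial coefficients and shifts of the lower index.

prev : (ℕ → ℕ) → ℕ → ℕ
prev f zero    = 0
prev f (suc r) = f r

-- Pascal's rule is the definition, so that it holds by computation and leaves polynomial identities
-- for the ring solver; `choose≡C` translates the final result to `_C_`.
choose : ℕ → ℕ → ℕ
choose n       zero    = 1
choose zero    (suc k) = 0
choose (suc n) (suc k) = choose n k + choose n (suc k)

choose≡C : ∀ n k → choose n k ≡ n C k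
choose≡C n       zero    = refl
choose≡C zero    (suc k) = refl
choose≡C (suc n) (suc k) =
  trans (cong₂ _+_ (choose≡C n k) (choose≡C n (suc k))) (nCk+nC[k+1]≡[n+1]C[k+1] n k)

-- chooseⱼ n r is the binomial coefficient of n over r − j, with value 0 for r < j.
choose₁ choose₂ choose₃ : ℕ → ℕ → ℕ
choose₁ n = prev (choose n)
choose₂ n = prev (choose₁ n)
choose₃ n = prev (choose₂ n)

choose-suc : ∀ n r → choose (suc n) r ≡ choose₁ n r + choose n r
choose-suc n zero    = refl
choose-suc n (suc r) = refl

choose₁-suc : ∀ n r → choose₁ (suc n) r ≡ choose₂ n r + choose₁ n r
choose₁-suc n zero    = refl
choose₁-suc n (suc r) = choose-suc n r

choose₂-suc : ∀ n r → choose₂ (suc n) r ≡ choose₃ n r + choose₂ n r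
choose₂-suc n zero    = refl
choose₂-suc n (suc r) = choose₁-suc n r

-- Sums over the stack of records.

-- ladder α β h = Σ_{i=1}^{h} (α i + (h − i) β i)
ladder : (ℕ → ℕ) → (ℕ → ℕ) → ℕ → ℕ
ladder α β zero    = 0
ladder α β (suc h) = α 1 + h * β 1 + ladder (λ i → α (suc i)) (λ i → β (suc i)) h

Σ₁ : (ℕ → ℕ) → ℕ → ℕ
Σ₁ α = ladder α (λ _ → 0)

-- Raising `h` increases each coefficient h - i by one, which adds one further `β i` for every i ≤ h
-- besides the new top term.
ladder-suc : ∀ (α β : ℕ → ℕ) h → ladder α β (suc h) ≡ ladder α β h + α (suc h) + Σ₁ β h
ladder-suc α β zero    = lem (α 1)
  where
  lem : ∀ a → a + 0 + 0 ≡ 0 + a + 0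
  lem = solve-∀
ladder-suc α β (suc h)
  rewrite ladder-suc (λ i → α (suc i)) (λ i → β (suc i)) h
  = lem (α 1) (β 1) h (ladder (λ i → α (suc i)) (λ i → β (suc i)) h) (α (2 + h))
        (Σ₁ (λ i → β (suc i)) h)
  where
  lem : ∀ a b h l c s →
        a + suc h * b + (l + c + s) ≡ (a + h * b + l) + c + (b + h * 0 + s)
  lem = solve-∀

Σ₁-suc : ∀ (α : ℕ → ℕ) h → Σ₁ α (suc h) ≡ Σ₁ α h + α (suc h)
Σ₁-suc α h = trans (ladder-suc α (λ _ → 0) h) (trans (cong (Σ₁ α h + α (suc h) +_) (zeros h)) (+-identityʳ _))
  where
  zeros : ∀ h → Σ₁ (λ _ → 0) h ≡ 0
  zeros zero    = refl
  zeros (suc h) = trans (cong (_+ Σ₁ (λ _ → 0) h) (*-zeroʳ h)) (zeros h)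

-- The two ladders differ by the sum of `β i` for 1 ≤ i ≤ h, and the hypothesis telescopes this sum
-- to the difference of `ψ (2 + h)` and `ψ 2`.
ladder-shift : ∀ (α β ψ : ℕ → ℕ) → (∀ i → ψ (2 + i) ≡ ψ (1 + i) + β i) → ∀ h →
  ladder (λ i → α i + β i) β h + ψ 2 ≡ ladder α β h + ψ (2 + h)
ladder-shift α β ψ step zero    = refl
ladder-shift α β ψ step (suc h) = begin
  α 1 + β 1 + h * β 1 + X + ψ 2
    ≡⟨ lem (α 1) (β 1) (h * β 1) X (ψ 2) ⟩
  α 1 + h * β 1 + (X + (ψ 2 + β 1))
    ≡⟨ cong (λ y → α 1 + h * β 1 + (X + y)) (step 1) ⟨
  α 1 + h * β 1 + (X + ψ 3)
    ≡⟨ cong (α 1 + h * β 1 +_) (ladder-shift _ _ (λ i → ψ (suc i)) (λ i → step (suc i)) h) ⟩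
  α 1 + h * β 1 + (Y + ψ (3 + h))
    ≡⟨ +-assoc (α 1 + h * β 1) Y (ψ (3 + h)) ⟨
  α 1 + h * β 1 + Y + ψ (3 + h) ∎
  where
  X = ladder (λ i → α (suc i) + β (suc i)) (λ i → β (suc i)) h
  Y = ladder (λ i → α (suc i)) (λ i → β (suc i)) h
  lem : ∀ a b c x p → a + b + c + x + p ≡ a + c + (x + (p + b))
  lem = solve-∀

-- Completions of excess zero.

-- The number of excess-free completions by n letters of a prefix with h records, when r letters are
-- still unseen: a new letter is a new record, and reading the i-th smallest record leaves i records.
F : ℕ → ℕ → ℕ → ℕ
F zero    h zero    = 1
F zero    h (suc r) = 0
F (suc n) h r       = prev (F n (suc h)) r + Σ₁ (λ i → F n i r) h

-- F n (2 + h) r − F n (1 + h) r, without subtraction: this is what one almost-record contributes.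
ΔF : ℕ → ℕ → ℕ → ℕ
ΔF zero    h r = 0
ΔF (suc n) h r = prev (ΔF n (suc h)) r + F n (2 + h) r

-- The recurrences for adjacent numbers of records share all summands of `Σ₁` but the last, so their
-- difference obeys the recurrence that defines `ΔF`.
F-step : ∀ n h r → F n (2 + h) r ≡ F n (1 + h) r + ΔF n h r
F-step zero    h zero    = refl
F-step zero    h (suc r) = refl
F-step (suc n) h r
  rewrite Σ₁-suc (λ i → F n i r) (suc h)
  = trans (cong (_+ (S + F n (2 + h) r)) (prev-step r))
          (lem (prev (F n (2 + h)) r) (prev (ΔF n (suc h)) r) S (F n (2 + h) r))
  where
  S = Σ₁ (λ i → F n i r) (suc h)
  prev-step : ∀ r → prev (F n (3 + h)) r ≡ prev (F n (2 + h)) r + prev (ΔF n (suc h)) r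
  prev-step zero    = refl
  prev-step (suc r) = F-step n (suc h) r
  lem : ∀ a b s f → a + b + (s + f) ≡ a + s + (b + f)
  lem = solve-∀

choose-above : ∀ n j → choose n (suc (j + n)) ≡ 0
choose-above zero    j = refl
choose-above (suc n) j rewrite +-suc j n | choose-above n j = choose-above n (suc j)

choose-self : ∀ n → choose n n ≡ 1
choose-self zero    = refl
choose-self (suc n) = cong₂ _+_ (choose-self n) (choose-above n 0)

-- Adds two identities whose negative terms stand on the left. The last hypothesis no longer
-- contains `x₁` and `x₂`, so it can be a polynomial identity in binomial coefficients.
combine₂ : ∀ {x₁ x₂ a₁ a₂ b₁ b₂ a b} → x₁ + a₁ ≡ b₁ → x₂ + a₂ ≡ b₂ →
  a + (b₁ + b₂) ≡ b + (a₁ + a₂) → x₁ + x₂ + a ≡ b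
combine₂ {x₁} {x₂} {a₁} {a₂} {a = a} {b} refl refl eq =
  +-cancelʳ-≡ (a₁ + a₂) (x₁ + x₂ + a) b (trans (lem x₁ x₂ a₁ a₂ a) eq)
  where
  lem : ∀ x₁ x₂ a₁ a₂ a → x₁ + x₂ + a + (a₁ + a₂) ≡ a + (x₁ + a₁ + (x₂ + a₂))
  lem = solve-∀

-- F is a difference of two products of binomial coefficients; the negative term is moved to the left.
F-closed : ∀ n h r → F n (1 + h) r + choose₁ n r * choose (h + n) (1 + (h + r)) ≡
                     choose n r * choose (h + n) (h + r)
-- Subtract the closed forms of `F` for adjacent numbers of records and simplify by Pascal's rule in
-- the second factors.
ΔF-closed : ∀ n h r → ΔF n h r + choose₁ n r * choose (h + n) (2 + (h + r)) ≡
                      choose n r * choose (h + n) (1 + (h + r))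
F-closed-prev : ∀ n h r → prev (F n (2 + h)) r + choose₂ n r * choose (1 + h + n) (1 + (h + r)) ≡
                          choose₁ n r * choose (1 + h + n) (h + r)
F-closed-prev n h zero    = refl
F-closed-prev n h (suc r) rewrite +-suc h r = F-closed n (suc h) r

ΔF-closed-prev : ∀ n h r →
  prev (ΔF n (1 + h)) r + choose₂ n r * choose (1 + h + n) (2 + (h + r)) ≡
  choose₁ n r * choose (1 + h + n) (1 + (h + r))
ΔF-closed-prev n h zero    = refl
ΔF-closed-prev n h (suc r) rewrite +-suc h r = ΔF-closed n (suc h) r

F-closed zero    h zero rewrite +-identityʳ h = cong (_+ 0) (sym (choose-self h))
F-closed zero    h (suc r)
  rewrite +-identityʳ h | +-comm h (suc r) | choose-above h (suc r) = *-zeroʳ (choose₁ 0 (suc r))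
F-closed (suc n) zero r =
  trans (cong (λ y → prev (F n 2) r + y + choose₁ (suc n) r * choose (suc n) (suc r)) (lem₀ (F n 1 r)))
    (combine₂ {prev (F n 2) r} {F n 1 r} (F-closed-prev n 0 r) (F-closed n 0 r) poly)
  where
  lem₀ : ∀ f → f + 0 + 0 ≡ f
  lem₀ = solve-∀
  lem : ∀ b c d e → (d + c) * (b + e) + (c * (c + b) + b * b) ≡
                    (c + b) * (c + b) + (d * (b + e) + c * e)
  lem = solve-∀
  poly : choose₁ (suc n) r * choose (suc n) (suc r) +
           (choose₁ n r * choose (suc n) r + choose n r * choose n r) ≡
         choose (suc n) r * choose (suc n) r +
           (choose₂ n r * choose (suc n) (suc r) + choose₁ n r * choose n (suc r))
  poly rewrite choose-suc n r | choose₁-suc n r =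
    lem (choose n r) (choose₁ n r) (choose₂ n r) (choose n (suc r))
-- Descending in `h` by `F-step` avoids a closed form for `Σ₁`: the increment unfolds to `ΔF` and
-- `F` at `n`.
F-closed (suc n) (suc h) r =
  trans (cong (_+ a) (F-step (suc n) h r))
    (combine₂ {F (suc n) (1 + h) r} (F-closed (suc n) h r)
      (combine₂ {prev (ΔF n (suc h)) r} (ΔF-closed-prev n h r) (F-closed n (suc h) r) refl-sum)
      poly)
  where
  N = suc (h + n)
  a = choose₁ (suc n) r * choose (suc h + suc n) (1 + (suc h + r))
  q : ℕ → ℕ
  q i = choose N (i + (h + r))
  refl-sum : choose₂ n r * q 2 + choose₁ n r * q 2 + (choose₁ n r * q 1 + choose n r * q 1) ≡
             choose₁ n r * q 1 + choose n r * q 1 + (choose₂ n r * q 2 + choose₁ n r * q 2)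
  refl-sum = +-comm (choose₂ n r * q 2 + choose₁ n r * q 2) _
  lem : ∀ b c d q₀ q₁ q₂ →
    (d + c) * (q₁ + q₂) + ((c + b) * q₀ + (c * q₁ + b * q₁)) ≡
    (c + b) * (q₀ + q₁) + ((d + c) * q₁ + (d * q₂ + c * q₂))
  lem = solve-∀
  poly : a + (choose (suc n) r * choose (h + suc n) (h + r) +
              (choose₁ n r * q 1 + choose n r * q 1)) ≡
         choose (suc n) r * choose (suc h + suc n) (suc h + r) +
              (choose₁ (suc n) r * choose (h + suc n) (1 + (h + r)) +
               (choose₂ n r * q 2 + choose₁ n r * q 2))
  poly rewrite +-suc h n | choose-suc n r | choose₁-suc n r =
    lem (choose n r) (choose₁ n r) (choose₂ n r) (q 0) (q 1) (q 2)

ΔF-closed n h r = +-cancelˡ-≡ (F n (1 + h) r + choose₁ n r * p 1) _ _ (begin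
  F n (1 + h) r + c * p 1 + (ΔF n h r + c * p 2)
    ≡⟨ lem (F n (1 + h) r) (ΔF n h r) c (p 1) (p 2) ⟩
  F n (1 + h) r + ΔF n h r + c * (p 1 + p 2)
    ≡⟨ cong (_+ c * (p 1 + p 2)) (F-step n h r) ⟨
  F n (2 + h) r + c * (p 1 + p 2)
    ≡⟨ F-closed n (suc h) r ⟩
  b * (p 0 + p 1)
    ≡⟨ *-distribˡ-+ b (p 0) (p 1) ⟩
  b * p 0 + b * p 1
    ≡⟨ cong (_+ b * p 1) (F-closed n h r) ⟨
  F n (1 + h) r + c * p 1 + b * p 1 ∎)
  where
  b = choose n r
  c = choose₁ n r
  p : ℕ → ℕ
  p i = choose (h + n) (i + (h + r))
  lem : ∀ f g c p₁ p₂ → f + c * p₁ + (g + c * p₂) ≡ f + g + c * (p₁ + p₂)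
  lem = solve-∀

-- Completions of excess one.

ΔG : ℕ → ℕ → ℕ → ℕ
ΔG n h r = choose₂ n r * choose (h + n) (3 + (h + r))
         + choose₁ n r * choose (1 + h + n) (3 + (h + r))
         + h * (choose n r * choose (h + n) (2 + (h + r)))

-- The number of completions with excess 1 of a prefix with h records and no almost-records.
G : ℕ → ℕ → ℕ → ℕ
G n zero    r = choose₂ n r * choose n (2 + r)
G n (suc h) r = G n h r + ΔG n h r

prev-ΔG : ∀ n h r → prev (ΔG n (suc h)) r ≡
    choose₃ n r * choose (1 + h + n) (3 + (h + r))
  + choose₂ n r * choose (2 + h + n) (3 + (h + r))
  + suc h * (choose₁ n r * choose (1 + h + n) (2 + (h + r)))
prev-ΔG n h zero    = sym (*-zeroʳ (suc h))
prev-ΔG n h (suc r) rewrite +-suc h r = refl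

-- This is `G-suc` differenced in `h`, with `ladder-suc` applied to the ladder. It is proved by
-- differencing once more: from `h` to `suc h` the sum `Σ₁` gains one `ΔF` and `G` gains one `ΔG`,
-- and all remaining terms have closed forms.
ΔG-suc : ∀ n h r →
  ΔG (suc n) h r ≡ prev (ΔG n (suc h)) r + G n (suc h) r + Σ₁ (λ i → ΔF n i r) h
ΔG-suc n zero r
  rewrite prev-ΔG n 0 r | choose₁-suc n r | choose₂-suc n r
  = lem (choose n r) (choose₁ n r) (choose₂ n r) (choose₃ n r)
        (choose n (1 + r)) (choose n (2 + r)) (choose n (3 + r))
  where
  lem : ∀ b c d e q₁ q₂ q₃ →
    (e + d) * (q₂ + q₃) + (d + c) * ((q₁ + q₂) + (q₂ + q₃)) + 0 ≡
    e * (q₂ + q₃) + d * ((q₁ + q₂) + (q₂ + q₃)) + 1 * (c * (q₁ + q₂)) +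
    (d * q₂ + (d * q₃ + c * (q₂ + q₃) + 0)) + 0
  lem = solve-∀
ΔG-suc n (suc h) r
  -- Adding `a`, the negative part of the closed form of `ΔF`, and `x`, the term subtracted with the
  -- case `h`, replaces subtraction.
  rewrite Σ₁-suc (λ i → ΔF n i r) h = +-cancelʳ-≡ (a + x) _ _ (begin
  ΔG (suc n) (suc h) r + (a + x)
    ≡⟨ +-assoc (ΔG (suc n) (suc h) r) a x ⟨
  ΔG (suc n) (suc h) r + a + x
    ≡⟨ poly ⟩
  ΔG (suc n) h r + prev (ΔG n (2 + h)) r + ΔG n (suc h) r + choose n r * q 2
    ≡⟨ cong₂ (λ y z → y + prev (ΔG n (2 + h)) r + ΔG n (suc h) r + z) (ΔG-suc n h r)
             (sym (ΔF-closed n (suc h) r)) ⟩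
  (x + γ + s) + prev (ΔG n (2 + h)) r + ΔG n (suc h) r + (f + a)
    ≡⟨ lem′ x γ s (prev (ΔG n (2 + h)) r) (ΔG n (suc h) r) f a ⟩
  prev (ΔG n (2 + h)) r + (γ + ΔG n (suc h) r) + (s + f) + (a + x) ∎)
  where
  q : ℕ → ℕ
  q i = choose (suc (h + n)) (i + (h + r))
  a = choose₁ n r * q 3
  x = prev (ΔG n (suc h)) r
  γ = G n (suc h) r
  s = Σ₁ (λ i → ΔF n i r) h
  f = ΔF n (suc h) r
  lem′ : ∀ x γ s y z f a → x + γ + s + y + z + (f + a) ≡ y + (γ + z) + (s + f) + (a + x)
  lem′ = solve-∀
  lem : ∀ h b c d e q₁ q₂ q₃ q₄ →
    (e + d) * (q₃ + q₄) + (d + c) * ((q₂ + q₃) + (q₃ + q₄)) + suc h * ((c + b) * (q₂ + q₃))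
      + c * q₃ + (e * q₃ + d * (q₂ + q₃) + suc h * (c * q₂)) ≡
    ((e + d) * q₃ + (d + c) * (q₂ + q₃) + h * ((c + b) * q₂))
      + (e * (q₃ + q₄) + d * ((q₂ + q₃) + (q₃ + q₄)) + suc (suc h) * (c * (q₂ + q₃)))
      + (d * q₄ + c * (q₃ + q₄) + suc h * (b * q₃)) + b * q₂
  lem = solve-∀
  poly : ΔG (suc n) (suc h) r + a + x ≡
         ΔG (suc n) h r + prev (ΔG n (2 + h)) r + ΔG n (suc h) r + choose n r * q 2
  poly rewrite prev-ΔG n h r | prev-ΔG n (suc h) r
             | +-suc h n | choose-suc n r | choose₁-suc n r | choose₂-suc n r
    = lem h (choose n r) (choose₁ n r) (choose₂ n r) (choose₃ n r) (q 1) (q 2) (q 3) (q 4)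

-- The recurrence by first letter: either a new letter, or the i-th record, which leaves i records
-- and turns the h - i records above it into almost-records, each worth `ΔF n i r`. Induction on `h`
-- reduces it to `ΔG-suc`.
G-suc : ∀ n h r →
  G (suc n) h r ≡ prev (G n (suc h)) r + ladder (λ i → G n i r) (λ i → ΔF n i r) h
G-suc n zero r = trans (poly r) (sym (+-identityʳ _))
  where
  lem : ∀ d e q₁ q₂ → (e + d) * (q₁ + q₂) ≡
    e * q₁ + (e * q₂ + d * (q₁ + q₂) + 0)
  lem = solve-∀
  poly : ∀ r → choose₂ (suc n) r * choose (suc n) (2 + r) ≡ prev (G n 1) r
  poly zero    = refl
  poly (suc r) rewrite choose₁-suc n r =
    lem (choose₁ n r) (choose₂ n r) (choose n (2 + r)) (choose n (3 + r))
G-suc n (suc h) r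
  rewrite G-suc n h r | ΔG-suc n h r
        | ladder-suc (λ i → G n i r) (λ i → ΔF n i r) h
  = trans (lem (prev (G n (suc h)) r) (ladder (λ i → G n i r) (λ i → ΔF n i r) h)
               (prev (ΔG n (suc h)) r) (G n h r + ΔG n h r) (Σ₁ (λ i → ΔF n i r) h))
          (cong (_+ (ladder (λ i → G n i r) (λ i → ΔF n i r) h + G n (suc h) r
                     + Σ₁ (λ i → ΔF n i r) h)) (prev-G r))
  where
  lem : ∀ p l d g s → p + l + (d + g + s) ≡ p + d + (l + g + s)
  lem = solve-∀
  prev-G : ∀ r → prev (G n (suc h)) r + prev (ΔG n (suc h)) r ≡ prev (G n (2 + h)) r
  prev-G zero    = refl
  prev-G (suc r) = refl

G-zero : ∀ h r → G 0 h r ≡ 0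
G-zero zero    r = *-zeroʳ (choose₂ 0 r)
G-zero (suc h) r
  rewrite G-zero h r | +-identityʳ h | +-comm h r
        | choose-above h (2 + r) | choose-above h (1 + r)
  = lem h (choose₂ 0 r) (choose₁ 0 r) (choose 0 r)
  where
  lem : ∀ h x y z → x * 0 + y * 0 + h * (z * 0) ≡ 0
  lem = solve-∀

-- Indicators and Boolean comparisons.

𝟙 : Bool → ℕ
𝟙 true  = 1
𝟙 false = 0

sum-if : ∀ {b} (o : Fin b) t (f : Fin b → ℕ) → f o ≡ 0 →
         sum (λ x → if does (o ≟ x) then t else f x) ≡ t + sum f
sum-if zero    t f f0 rewrite f0 = refl
sum-if (suc o) t f f0 = begin
  f zero + sum (λ x → if does (o ≟ x) then t else f (suc x))
    ≡⟨ cong (f zero +_) (sum-if o t (f ∘ suc) f0) ⟩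
  f zero + (t + sum (f ∘ suc))
    ≡⟨ lem (f zero) t (sum (f ∘ suc)) ⟩
  t + (f zero + sum (f ∘ suc)) ∎
  where
  lem : ∀ a t s → a + (t + s) ≡ t + (a + s)
  lem = solve-∀

sum-δ : ∀ {b} (o : Fin b) t → sum (λ x → if does (o ≟ x) then t else 0) ≡ t
sum-δ {b} o t = trans (sum-if o t (λ _ → 0) refl) (trans (cong (t +_) (sum-replicate-zero b)) (+-identityʳ t))

<ᵇ-true : ∀ {m n} → m < n → (m <ᵇ n) ≡ true
<ᵇ-true {m} {n} m<n with m <ᵇ n in eq
... | true  = refl
... | false = ⊥-elim (subst T eq (<⇒<ᵇ m<n))

<ᵇ-false : ∀ {m n} → n ≤ m → (m <ᵇ n) ≡ false
<ᵇ-false {m} {n} n≤m with m <ᵇ n in eq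
... | false = refl
... | true  = contradiction (<ᵇ⇒< m n (subst T (sym eq) tt)) (≤⇒≯ n≤m)

true-<ᵇ : ∀ {m n} → (m <ᵇ n) ≡ true → m < n
true-<ᵇ {m} {n} eq = <ᵇ⇒< m n (subst T (sym eq) tt)

≡ᵇ-refl : ∀ m → (m ≡ᵇ m) ≡ true
≡ᵇ-refl zero    = refl
≡ᵇ-refl (suc m) = ≡ᵇ-refl m

≡ᵇ-false : ∀ {m n} → m ≢ n → (m ≡ᵇ n) ≡ false
≡ᵇ-false {m} {n} m≢n with m ≡ᵇ n in eq
... | false = refl
... | true  = contradiction (≡ᵇ⇒≡ m n (subst T (sym eq) tt)) m≢n

-- The list of seen letters, its records and its almost-records.

module _ {b : ℕ} where

  ΣW : ℕ → (List (Fin b) → ℕ) → ℕ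
  ΣW zero    f = f []
  ΣW (suc n) f = sum (λ x → ΣW n (λ w → f (x ∷ w)))

  ΣW-cong : ∀ n {f g} → (∀ w → f w ≡ g w) → ΣW n f ≡ ΣW n g
  ΣW-cong zero    eq = eq []
  ΣW-cong (suc n) eq = sum-cong-≗ (λ x → ΣW-cong n (λ w → eq (x ∷ w)))

  ΣW-zero : ∀ n {f} → (∀ w → f w ≡ 0) → ΣW n f ≡ 0
  ΣW-zero zero    eq = eq []
  ΣW-zero (suc n) eq = trans (sum-cong-≗ (λ x → ΣW-zero n (λ w → eq (x ∷ w)))) (sum-replicate-zero b)

  mem : List (Fin b) → Fin b → Bool
  mem []      x = false
  mem (o ∷ l) x = if does (o ≟ x) then true else mem l x

  Unique : List (Fin b) → Set
  Unique []      = ⊤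
  Unique (o ∷ l) = mem l o ≡ false × Unique l

  -- The letters seen so far are listed from the least to the most recent one.
  moveToEnd : Fin b → List (Fin b) → List (Fin b)
  moveToEnd x []      = x ∷ []
  moveToEnd x (o ∷ l) = if does (o ≟ x) then l ∷ʳ x else o ∷ moveToEnd x l

  leq : Fin b → Fin b → Bool
  leq x y = toℕ x <ᵇ suc (toℕ y)

  -- The letters ≤ x; since the lists have no repetitions, ≤ and < agree wherever this is used.
  lower : Fin b → List (Fin b) → ℕ
  lower x []      = 0
  lower x (o ∷ l) = 𝟙 (leq o x) + lower x l

  excessAt : List (Fin b) → Fin b → ℕ
  -- A first occurrence costs nothing.
  excessAt []      x = 0
  excessAt (o ∷ l) x = if does (o ≟ x) then lower x l else excessAt l x

  is0 is1 : ℕ → ℕ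
  is0 zero    = 1
  is0 (suc _) = 0
  is1 zero    = 0
  is1 (suc n) = is0 n

  records almost : List (Fin b) → ℕ
  records []      = 0
  records (o ∷ l) = is0 (lower o l) + records l
  almost []      = 0
  almost (o ∷ l) = is1 (lower o l) + almost l

  mem-snoc : ∀ l x y → mem (l ∷ʳ x) y ≡ (if does (x ≟ y) then true else mem l y)
  mem-snoc []      x y = refl
  mem-snoc (o ∷ l) x y with o ≟ y
  ... | no _ = mem-snoc l x y
  ... | yes _ with x ≟ y
  ...   | yes _ = refl
  ...   | no _  = refl

  mem-moveToEnd : ∀ x l y → mem (moveToEnd x l) y ≡ (if does (x ≟ y) then true else mem l y)
  mem-moveToEnd x []      y = refl
  mem-moveToEnd x (o ∷ l) y with o ≟ x
  ... | yes refl = trans (mem-snoc l x y) (lem (does (o ≟ y)))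
    where
    lem : ∀ c → (if c then true else mem l y) ≡ (if c then true else (if c then true else mem l y))
    lem true  = refl
    lem false = refl
  ... | no _ with o ≟ y
  ...   | no _  = mem-moveToEnd x l y
  ...   | yes _ with x ≟ y
  ...     | yes _ = refl
  ...     | no _  = refl

  Unique-snoc : ∀ l x → mem l x ≡ false → Unique l → Unique (l ∷ʳ x)
  Unique-snoc []      x x∉ _ = refl , tt
  Unique-snoc (o ∷ l) x x∉ (o∉ , u) with o ≟ x
  ... | no o≢x rewrite mem-snoc l x o | dec-false (x ≟ o) (o≢x ∘ sym) = o∉ , Unique-snoc l x x∉ u

  Unique-moveToEnd : ∀ x l → Unique l → Unique (moveToEnd x l)
  Unique-moveToEnd x []      _ = refl , tt
  Unique-moveToEnd x (o ∷ l) (o∉ , u) with o ≟ x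
  ... | yes refl = Unique-snoc l x o∉ u
  ... | no o≢x rewrite mem-moveToEnd x l o | dec-false (x ≟ o) (o≢x ∘ sym) = o∉ , Unique-moveToEnd x l u

  lower-snoc : ∀ y l o → lower y (l ∷ʳ o) ≡ 𝟙 (leq o y) + lower y l
  lower-snoc y []      o = refl
  lower-snoc y (p ∷ l) o rewrite lower-snoc y l o = lem (𝟙 (leq p y)) (𝟙 (leq o y)) (lower y l)
    where
    lem : ∀ a c s → a + (c + s) ≡ c + (a + s)
    lem = solve-∀

  lower-moveToEnd : ∀ y x l → mem l x ≡ true → lower y (moveToEnd x l) ≡ lower y l
  lower-moveToEnd y x (o ∷ l) x∈ with o ≟ x
  ... | yes refl = lower-snoc y l o
  ... | no _     = cong (𝟙 (leq o y) +_) (lower-moveToEnd y x l x∈)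

  lower-mono : ∀ {y o} l → toℕ y ≤ toℕ o → lower y l ≤ lower o l
  lower-mono []      y≤o = z≤n
  lower-mono {y} {o} (p ∷ l) y≤o = +-mono-≤ 𝟙-mono (lower-mono l y≤o)
    where
    𝟙-mono : 𝟙 (leq p y) ≤ 𝟙 (leq p o)
    𝟙-mono with leq p y in eq
    ... | false = z≤n
    ... | true rewrite <ᵇ-true {toℕ p} {suc (toℕ o)} (≤-trans (true-<ᵇ {toℕ p} eq) (s≤s y≤o)) = ≤-refl

  -- All letters of `l` exceed `o`, so appending `o` gives each of them one more smaller letter
  -- after it: only `o` is a record, and the former records are the almost-records.
  records-snoc₀ : ∀ l o → lower o l ≡ 0 → records (l ∷ʳ o) ≡ 1 × almost (l ∷ʳ o) ≡ records l
  records-snoc₀ []      o _  = refl , refl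
  records-snoc₀ (y ∷ l) o eq with ≤-<-connex (toℕ y) (toℕ o)
  ... | inj₁ y≤o rewrite <ᵇ-true (s≤s y≤o) = contradiction eq λ ()
  ... | inj₂ o<y rewrite <ᵇ-false {toℕ y} {suc (toℕ o)} o<y
                       | lower-snoc y l o | <ᵇ-true (s≤s (<⇒≤ o<y)) =
    let r , a = records-snoc₀ l o eq in r , cong (is0 (lower y l) +_) a

  -- The two records are `o` and the one letter of `l` below it; every other letter exceeds `o` and
  -- is followed by it.
  records-snoc₁ : ∀ l o → mem l o ≡ false → lower o l ≡ 1 → records (l ∷ʳ o) ≡ 2
  records-snoc₁ (y ∷ l) o o∉ eq with y ≟ o
  ... | no y≢o with ≤-<-connex (toℕ y) (toℕ o)
  ...   | inj₂ o<y rewrite <ᵇ-false {toℕ y} {suc (toℕ o)} o<y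
                         | lower-snoc y l o | <ᵇ-true (s≤s (<⇒≤ o<y)) = records-snoc₁ l o o∉ eq
  -- Here `y` is the one letter below `o`; by `lower-mono` no letter below `y` follows it, so it
  -- stays a record.
  ...   | inj₁ y≤o rewrite <ᵇ-true (s≤s y≤o)
                         | lower-snoc y l o | <ᵇ-false (≤∧≢⇒< y≤o (y≢o ∘ toℕ-injective))
                         | n≤0⇒n≡0 (subst (lower y l ≤_) (suc-injective eq) (lower-mono l y≤o))
                         = cong suc (proj₁ (records-snoc₀ l o (suc-injective eq)))

  mem-here : ∀ o l → mem (o ∷ l) o ≡ true
  mem-here o l rewrite dec-true (o ≟ o) refl = refl

  mem-there : ∀ o l y → mem l y ≡ true → mem (o ∷ l) y ≡ true
  mem-there o l y y∈ with o ≟ y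
  ... | yes _ = refl
  ... | no _  = y∈

  lower-new : ∀ x o l → mem l x ≡ false → toℕ o < toℕ x → lower o (moveToEnd x l) ≡ lower o l
  lower-new x o []      _  o<x rewrite <ᵇ-false o<x = refl
  lower-new x o (p ∷ l) x∉ o<x with p ≟ x
  ... | no _ = cong (𝟙 (leq p o) +_) (lower-new x o l x∉ o<x)

  -- The new letter exceeds all others, so it changes none of their counts and is itself a record at
  -- the end of the list.
  records-new : ∀ x l → mem l x ≡ false → (∀ y → mem l y ≡ true → toℕ y < toℕ x) →
            records (moveToEnd x l) ≡ suc (records l) × almost (moveToEnd x l) ≡ almost l
  records-new x []      _  _  = refl , refl
  records-new x (o ∷ l) x∉ l<x with o ≟ x
  ... | no _ rewrite lower-new x o l x∉ (l<x o (mem-here o l)) =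
    let r , a = records-new x l x∉ (λ y y∈ → l<x y (mem-there o l y y∈))
    in trans (cong (is0 (lower o l) +_) r) (+-suc (is0 (lower o l)) (records l)) , cong (is1 (lower o l) +_) a

  pick : ℕ → ℕ → ℕ → ℕ
  pick 0 a c = a
  pick 1 a c = c
  pick (suc (suc _)) a c = 0

  -- `φ` weighs the state after a letter without excess, `ψ` the state after a letter that spends
  -- the single unit of excess.
  advance : (ℕ → ℕ → ℕ) → (ℕ → ℕ) → List (Fin b) → Fin b → ℕ
  advance φ ψ l x =
    pick (excessAt l x) (φ (records (moveToEnd x l)) (almost (moveToEnd x l))) (ψ (records (moveToEnd x l)))

  advance∈ : (ℕ → ℕ → ℕ) → (ℕ → ℕ) → List (Fin b) → Fin b → ℕ
  advance∈ φ ψ l x = if mem l x then advance φ ψ l x else 0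

  -- Appending an older letter o to the list shifts the arguments of φ and ψ according to whether o is
  -- a record, an almost-record or neither, so the induction needs arbitrary φ linear in its second argument.
  sum-advance : ∀ l φ ψ α β → Unique l → (∀ h a → φ h a ≡ α h + a * β h) →
            (∀ i → ψ (2 + i) ≡ ψ (1 + i) + β i) →
            sum (advance∈ φ ψ l) ≡ ladder α β (records l) + almost l * ψ (2 + records l)
  sum-advance []      φ ψ α β _ _ _ = sum-replicate-zero b
  sum-advance (o ∷ l) φ ψ α β (o∉ , u) φ≡ ψ-step = begin
    sum (advance∈ φ ψ (o ∷ l))
      ≡⟨ sum-cong-≗ split ⟩
    sum (λ x → if does (o ≟ x) then t else advance∈ φ′ ψ′ l x)
      ≡⟨ sum-if o t (advance∈ φ′ ψ′ l) (cong (λ c → if c then advance φ′ ψ′ l o else 0) o∉) ⟩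
    t + sum (advance∈ φ′ ψ′ l)
      ≡⟨ by-lower (lower o l) refl ⟩
    ladder α β (records (o ∷ l)) + almost (o ∷ l) * ψ (2 + records (o ∷ l)) ∎
    where
    t = pick (lower o l) (φ (records (l ∷ʳ o)) (almost (l ∷ʳ o))) (ψ (records (l ∷ʳ o)))
    φ′ : ℕ → ℕ → ℕ
    φ′ h a = φ (is0 (lower o l) + h) (is1 (lower o l) + a)
    ψ′ : ℕ → ℕ
    ψ′ h = ψ (is0 (lower o l) + h)
    split : ∀ x → advance∈ φ ψ (o ∷ l) x ≡ (if does (o ≟ x) then t else advance∈ φ′ ψ′ l x)
    split x with o ≟ x
    ... | yes refl = refl
    ... | no _ with mem l x in x∈
    ...   | false = refl
    ...   | true rewrite lower-moveToEnd o x l x∈ = refl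
    by-lower : ∀ s → lower o l ≡ s →
      t + sum (advance∈ φ′ ψ′ l) ≡
      ladder α β (records (o ∷ l)) + almost (o ∷ l) * ψ (2 + records (o ∷ l))
    -- A record: reading `o` leaves one record and makes almost-records of those in `l`, which is
    -- the first term of the ladder. Reading a later letter keeps `o` as an extra record, hence the
    -- shift by `suc`.
    by-lower 0 eq rewrite eq | proj₁ (records-snoc₀ l o eq) | proj₂ (records-snoc₀ l o eq)
      | φ≡ 1 (records l)
      | sum-advance l (λ h → φ (suc h)) (ψ ∘ suc) (α ∘ suc) (β ∘ suc) u (φ≡ ∘ suc) (ψ-step ∘ suc)
      = sym (+-assoc (α 1 + records l * β 1) _ _)
    -- An almost-record: reading `o` leaves two records and yields `ψ 2`. Reading a later letter
    -- keeps `o` as an almost-record and yields an extra `β`; `ladder-shift` merges the two effects.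
    by-lower 1 eq rewrite eq | records-snoc₁ l o o∉ eq
      | sum-advance l (λ h a → φ h (suc a)) ψ (λ i → α i + β i) β u
          (λ h a → trans (φ≡ h (suc a)) (sym (+-assoc (α h) (β h) (a * β h)))) ψ-step
      = begin
        ψ 2 + (ladder (λ i → α i + β i) β (records l) + a)
          ≡⟨ lem (ψ 2) (ladder (λ i → α i + β i) β (records l)) a ⟩
        ladder (λ i → α i + β i) β (records l) + ψ 2 + a
          ≡⟨ cong (_+ a) (ladder-shift α β ψ ψ-step (records l)) ⟩
        ladder α β (records l) + ψ (2 + records l) + a
          ≡⟨ +-assoc (ladder α β (records l)) _ a ⟩
        ladder α β (records l) + (ψ (2 + records l) + a) ∎
      where
      a = almost l * ψ (2 + records l)
      lem : ∀ p x a → p + (x + a) ≡ x + p + a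
      lem = solve-∀
    by-lower (suc (suc s)) eq rewrite eq = sum-advance l φ ψ α β u φ≡ ψ-step

  -- Counting restricted growth words by excess.

  restrictedGrowth : ℕ → List (Fin b) → Bool
  -- All `b` letters must have occurred by the end.
  restrictedGrowth m []      = m ≡ᵇ b
  restrictedGrowth m (x ∷ w) =
    if toℕ x <ᵇ m then restrictedGrowth m w else
    if toℕ x ≡ᵇ m then restrictedGrowth (suc m) w else false

  excess : List (Fin b) → List (Fin b) → ℕ
  excess l []      = 0
  excess l (x ∷ w) = excessAt l x + excess (moveToEnd x l) w

  accepts : ℕ → ℕ → List (Fin b) → List (Fin b) → ℕ
  accepts k m l w = 𝟙 (restrictedGrowth m w ∧ (excess l w ≡ᵇ k))

  Seen : ℕ → List (Fin b) → Set
  Seen m l = Unique l × (∀ x → mem l x ≡ (toℕ x <ᵇ m))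

  Seen-old : ∀ {m l x} → Seen m l → toℕ x < m → Seen m (moveToEnd x l)
  Seen-old {m} {l} {x} (u , i) x<m = Unique-moveToEnd x l u , go
    where
    go : ∀ y → mem (moveToEnd x l) y ≡ (toℕ y <ᵇ m)
    go y rewrite mem-moveToEnd x l y with x ≟ y
    ... | yes refl = sym (<ᵇ-true x<m)
    ... | no _     = i y

  Seen-new : ∀ {m l x} → Seen m l → toℕ x ≡ m → Seen (suc m) (moveToEnd x l)
  Seen-new {m} {l} {x} (u , i) refl = Unique-moveToEnd x l u , go
    where
    go : ∀ y → mem (moveToEnd x l) y ≡ (toℕ y <ᵇ suc m)
    go y rewrite mem-moveToEnd x l y with x ≟ y
    ... | yes refl = sym (<ᵇ-true (n<1+n (toℕ x)))
    ... | no x≢y rewrite i y with <-cmp (toℕ y) (toℕ x)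
    ...   | tri< y<x _ _ rewrite <ᵇ-true y<x | <ᵇ-true (m<n⇒m<1+n y<x) = refl
    ...   | tri≈ _ y≡x _ = contradiction (toℕ-injective (sym y≡x)) x≢y
    ...   | tri> _ _ x<y rewrite <ᵇ-false (<⇒≤ x<y) | <ᵇ-false x<y = refl

  excessAt-∉ : ∀ l x → mem l x ≡ false → excessAt l x ≡ 0
  excessAt-∉ []      x _  = refl
  excessAt-∉ (o ∷ l) x x∉ with o ≟ x
  ... | no _ = excessAt-∉ l x x∉

  records-Seen-new : ∀ {m l x} → Seen m l → toℕ x ≡ m →
    records (moveToEnd x l) ≡ suc (records l) × almost (moveToEnd x l) ≡ almost l
  records-Seen-new {m} {l} {x} (_ , i) refl =
    records-new x l (trans (i x) (<ᵇ-false (≤-refl {m}))) (λ y y∈ → true-<ᵇ (trans (sym (i y)) y∈))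

  -- The first letter is a seen one, evaluated by `sum-advance`, or the least unseen one, or is
  -- rejected. The least unseen letter exists only if `r` is positive and leaves one unseen letter
  -- fewer, hence `prev N r`.
  sum-step : ∀ {m r l} (f : Fin b → ℕ) φ ψ α β (N : ℕ → ℕ) → m + r ≡ b → Seen m l →
    (∀ h a → φ h a ≡ α h + a * β h) → (∀ i → ψ (2 + i) ≡ ψ (1 + i) + β i) →
    (∀ x → toℕ x < m → f x ≡ advance φ ψ l x) →
    (∀ x r′ → toℕ x ≡ m → suc m + r′ ≡ b → f x ≡ N r′) →
    (∀ x → m < toℕ x → f x ≡ 0) →
    sum f ≡ prev N r + (ladder α β (records l) + almost l * ψ (2 + records l))
  sum-step {m} {r} {l} f φ ψ α β N m+r≡b (u , i) φ≡ ψ-step old new high = begin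
    sum f
      ≡⟨ sum-cong-≗ split ⟩
    sum (λ x → fresh x + advance∈ φ ψ l x)
      ≡⟨ ∑-distrib-+ fresh (advance∈ φ ψ l) ⟩
    sum fresh + sum (advance∈ φ ψ l)
      ≡⟨ cong₂ _+_ (sum-fresh r m+r≡b) (sum-advance l φ ψ α β u φ≡ ψ-step) ⟩
    prev N r + (ladder α β (records l) + almost l * ψ (2 + records l)) ∎
    where
    fresh : Fin b → ℕ
    fresh x = if toℕ x ≡ᵇ m then f x else 0
    split : ∀ x → f x ≡ fresh x + advance∈ φ ψ l x
    split x rewrite i x with <-cmp (toℕ x) m
    ... | tri< x<m x≢m _ rewrite <ᵇ-true x<m | ≡ᵇ-false x≢m = old x x<m
    ... | tri≈ _ refl _  rewrite <ᵇ-false (≤-refl {m}) | ≡ᵇ-refl m = sym (+-identityʳ (f x))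
    ... | tri> _ x≢m m<x rewrite <ᵇ-false (<⇒≤ m<x) | ≡ᵇ-false x≢m = high x m<x
    sum-fresh : ∀ r → m + r ≡ b → sum fresh ≡ prev N r
    sum-fresh zero eq = trans (sum-cong-≗ none) (sum-replicate-zero b)
      where
      none : ∀ x → fresh x ≡ 0
      none x rewrite ≡ᵇ-false {toℕ x} {m}
        (<⇒≢ (subst (toℕ x <_) (trans (sym eq) (+-identityʳ m)) (toℕ<n x))) = refl
    sum-fresh (suc r) eq = trans (sum-cong-≗ only) (sum-δ o (N r))
      where
      eq′ : suc m + r ≡ b
      eq′ = trans (sym (+-suc m r)) eq
      m<b : m < b
      m<b = subst (suc m ≤_) eq′ (m≤m+n (suc m) r)
      o = fromℕ< m<b
      only : ∀ x → fresh x ≡ (if does (o ≟ x) then N r else 0)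
      only x with o ≟ x
      ... | yes refl rewrite toℕ-fromℕ< m<b | ≡ᵇ-refl m = new o r (toℕ-fromℕ< m<b) eq′
      ... | no o≢x rewrite ≡ᵇ-false {toℕ x} {m}
        (λ x≡m → o≢x (toℕ-injective (trans (toℕ-fromℕ< m<b) (sym x≡m)))) = refl

  accepts-old : ∀ k {m} l {x} → toℕ x < m → ∀ w →
            accepts k m l (x ∷ w) ≡ 𝟙 (restrictedGrowth m w ∧ (excessAt l x + excess (moveToEnd x l) w ≡ᵇ k))
  accepts-old k l x<m w rewrite <ᵇ-true x<m = refl

  accepts-new : ∀ k {m} l {x} → Seen m l → toℕ x ≡ m → ∀ w →
    accepts k m l (x ∷ w) ≡ accepts k (suc m) (moveToEnd x l) w
  accepts-new k {m} l {x} (_ , i) refl w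
    rewrite excessAt-∉ l x (trans (i x) (<ᵇ-false (≤-refl {m}))) | <ᵇ-false (≤-refl {m}) | ≡ᵇ-refl m = refl

  accepts-high : ∀ k {m} l {x} → m < toℕ x → ∀ w → accepts k m l (x ∷ w) ≡ 0
  accepts-high k {m} l {x} m<x w rewrite <ᵇ-false (<⇒≤ m<x) | ≡ᵇ-false (<⇒≢ m<x ∘ sym) = refl

  -- An almost-record cannot be read without excess, so `ψ` is zero and `φ` ignores almost-records;
  -- `sum-step` is then the recurrence of `F`.
  count₀ : ∀ n {r m l} → m + r ≡ b → Seen m l → ΣW n (accepts 0 m l) ≡ F n (records l) r
  count₀ zero {zero} {m} refl _ rewrite +-identityʳ m | ≡ᵇ-refl m = refl
  count₀ zero {suc r} {m} refl _ rewrite ≡ᵇ-false (m≢1+m+n m ∘ (λ e → trans e (+-suc m r))) = refl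
  count₀ (suc n) {r} {m} {l} eq inv =
    trans (sum-step {r = r} _ (λ h _ → F n h r) (λ _ → 0) (λ h → F n h r) (λ _ → 0) (F n (suc (records l)))
             eq inv (λ h a → sym (trans (cong (F n h r +_) (*-zeroʳ a)) (+-identityʳ _))) (λ _ → refl)
             old new (λ x m<x → ΣW-zero n (accepts-high 0 l m<x)))
          (cong (prev (F n (suc (records l))) r +_)
            (trans (cong (Σ₁ (λ h → F n h r) (records l) +_) (*-zeroʳ (almost l))) (+-identityʳ _)))
    where
    old : ∀ x → toℕ x < m → ΣW n (λ w → accepts 0 m l (x ∷ w)) ≡ advance (λ h _ → F n h r) (λ _ → 0) l x
    old x x<m rewrite ΣW-cong n (accepts-old 0 l x<m) with excessAt l x
    ... | 0           = count₀ n eq (Seen-old inv x<m)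
    ... | 1           = ΣW-zero n (λ w → cong 𝟙 (∧-zeroʳ (restrictedGrowth m w)))
    ... | suc (suc _) = ΣW-zero n (λ w → cong 𝟙 (∧-zeroʳ (restrictedGrowth m w)))
    new : ∀ x r′ → toℕ x ≡ m → suc m + r′ ≡ b →
          ΣW n (λ w → accepts 0 m l (x ∷ w)) ≡ F n (suc (records l)) r′
    new x r′ x≡m eq′ = trans (ΣW-cong n (accepts-new 0 l inv x≡m))
      (trans (count₀ n {r′} eq′ (Seen-new inv x≡m)) (cong (λ h → F n h r′) (proj₁ (records-Seen-new inv x≡m))))

  -- Once the unit of excess is spent, `count₀` counts the rest, so `ψ` is `F`, and its telescoping
  -- condition is `F-step`.
  count₁ : ∀ n {r m l} → m + r ≡ b → Seen m l →
           ΣW n (accepts 1 m l) ≡ G n (records l) r + almost l * ΔF n (records l) r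
  count₁ zero {r} {m} {l} _ _ rewrite ∧-zeroʳ (m ≡ᵇ b) | G-zero (records l) r = sym (*-zeroʳ (almost l))
  count₁ (suc n) {r} {m} {l} eq inv =
    trans (sum-step {r = r} _ (λ h a → G n h r + a * ΔF n h r) (λ h → F n h r)
             (λ h → G n h r) (λ h → ΔF n h r) N
             eq inv (λ _ _ → refl) (λ h → F-step n h r)
             old new (λ x m<x → ΣW-zero n (accepts-high 1 l m<x)))
          collect
    where
    N : ℕ → ℕ
    N r = G n (suc (records l)) r + almost l * ΔF n (suc (records l)) r
    old : ∀ x → toℕ x < m →
          ΣW n (λ w → accepts 1 m l (x ∷ w)) ≡
          advance (λ h a → G n h r + a * ΔF n h r) (λ h → F n h r) l x
    old x x<m rewrite ΣW-cong n (accepts-old 1 l x<m) with excessAt l x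
    ... | 0           = count₁ n eq (Seen-old inv x<m)
    ... | 1           = count₀ n eq (Seen-old inv x<m)
    ... | suc (suc _) = ΣW-zero n (λ w → cong 𝟙 (∧-zeroʳ (restrictedGrowth m w)))
    new : ∀ x r′ → toℕ x ≡ m → suc m + r′ ≡ b → ΣW n (λ w → accepts 1 m l (x ∷ w)) ≡ N r′
    new x r′ x≡m eq′ = trans (ΣW-cong n (accepts-new 1 l inv x≡m))
      (trans (count₁ n {r′} eq′ (Seen-new inv x≡m))
        (let h , a = records-Seen-new inv x≡m in cong₂ (λ h a → G n h r′ + a * ΔF n h r′) h a))
    prev-N : ∀ r → prev N r ≡ prev (G n (suc (records l))) r + almost l * prev (ΔF n (suc (records l))) r
    prev-N zero    = sym (*-zeroʳ (almost l))
    prev-N (suc r) = refl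
    lem : ∀ g a d s f → g + a * d + (s + a * f) ≡ g + s + a * (d + f)
    lem = solve-∀
    -- The part free of `almost l` is the recurrence of `G`; the coefficient of `almost l` is that
    -- of `ΔF`.
    collect :
      prev N r + (ladder (λ h → G n h r) (λ h → ΔF n h r) (records l) + almost l * F n (2 + records l) r) ≡
      G (suc n) (records l) r + almost l * ΔF (suc n) (records l) r
    collect rewrite prev-N r | G-suc n (records l) r =
      lem (prev (G n (suc (records l))) r) (almost l) (prev (ΔF n (suc (records l))) r)
          (ladder (λ h → G n h r) (λ h → ΔF n h r) (records l)) (F n (2 + records l) r)

  -- With no letter seen there are no records, and `G` takes its initial value, which is already a
  -- product.
  count : ∀ n → ΣW n (accepts 1 0 []) ≡ choose₂ n b * choose n (2 + b)
  count n = trans (count₁ n {b} {0} {[]} refl (tt , λ _ → refl)) (+-identityʳ _)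

-- Sums over levels and card permutations.

sum-< : ∀ {b} (c : Fin b) → sum (λ (i : Fin b) → 𝟙 (toℕ i <ᵇ toℕ c)) ≡ toℕ c
sum-< {suc b} zero    = sum-replicate-zero b
sum-< {suc b} (suc c) = cong suc (sum-< c)

sum-toℕ : ∀ b → 2 * sum {b} toℕ ≡ b * (b ∸ 1)
sum-toℕ zero    = refl
sum-toℕ (suc b) = begin
  2 * sum {b} (suc ∘ toℕ)
    ≡⟨ cong (2 *_) (∑-distrib-+ {b} (λ _ → 1) toℕ) ⟩
  2 * (sum {b} (λ _ → 1) + sum {b} toℕ)
    ≡⟨ cong (λ y → 2 * (y + sum {b} toℕ)) (ones b) ⟩
  2 * (b + sum {b} toℕ)
    ≡⟨ *-distribˡ-+ 2 b _ ⟩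
  2 * b + 2 * sum {b} toℕ
    ≡⟨ cong (2 * b +_) (sum-toℕ b) ⟩
  2 * b + b * (b ∸ 1)
    ≡⟨ last b ⟩
  suc b * b ∎
  where
  ones : ∀ b → sum {b} (λ _ → 1) ≡ b
  ones zero    = refl
  ones (suc b) = cong suc (ones b)
  lem : ∀ b → 2 * suc b + suc b * b ≡ suc (suc b) * suc b
  lem = solve-∀
  last : ∀ b → 2 * b + b * (b ∸ 1) ≡ suc b * b
  last zero    = refl
  last (suc b) = lem b

punchIn-< : ∀ {b} (c : Fin (suc b)) j → toℕ j < toℕ c → punchIn c j ≡ inject₁ j
punchIn-< (suc c) zero    _         = refl
punchIn-< (suc c) (suc j) (s≤s j<c) = cong suc (punchIn-< c j j<c)

punchIn-≥ : ∀ {b} (c : Fin (suc b)) j → toℕ c ≤ toℕ j → punchIn c j ≡ suc j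
punchIn-≥ zero    j       _         = refl
punchIn-≥ (suc c) (suc j) (s≤s c≤j) = cong suc (punchIn-≥ c j c≤j)

-- The unthrown balls keep their order and leave level `c` free. Injectivity and monotonicity are
-- thereby inherited from `punchIn`.
cardPerm-suc : ∀ {b} (c : Fin (suc b)) j → cardPerm c (suc j) ≡ punchIn c j
cardPerm-suc c j with toℕ (suc j) ≤? toℕ c
... | yes j<c = sym (punchIn-< c j j<c)
... | no  j≮c = sym (punchIn-≥ c j (≮⇒≥ j≮c))

cardPerm-above : ∀ {b} (c j : Fin b) → toℕ c < toℕ j → cardPerm c j ≡ j
cardPerm-above c (suc j) c<j with toℕ (suc j) ≤? toℕ c
... | yes j≤c = contradiction j≤c (<⇒≱ c<j)
... | no _    = refl

cardPerm-injective : ∀ {b} (c : Fin b) {i j} → cardPerm c i ≡ cardPerm c j → i ≡ j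
cardPerm-injective c {zero}  {zero}  eq = refl
cardPerm-injective c {zero}  {suc j} eq =
  contradiction (sym (trans eq (cardPerm-suc c j))) (punchInᵢ≢i c j)
cardPerm-injective c {suc i} {zero}  eq =
  contradiction (trans (sym (cardPerm-suc c i)) eq) (punchInᵢ≢i c i)
cardPerm-injective c {suc i} {suc j} eq =
  cong suc (punchIn-injective c i j (trans (sym (cardPerm-suc c i)) (trans eq (cardPerm-suc c j))))

cardPerm-<ᵇ : ∀ {b} (c : Fin (suc b)) i j →
  (toℕ (cardPerm c (suc i)) <ᵇ toℕ (cardPerm c (suc j))) ≡ (toℕ i <ᵇ toℕ j)
cardPerm-<ᵇ c i j rewrite cardPerm-suc c i | cardPerm-suc c j with <-≤-connex (toℕ i) (toℕ j)
... | inj₁ i<j = trans (<ᵇ-true (≰⇒> (λ le → <⇒≱ i<j (punchIn-cancel-≤ c j i le)))) (sym (<ᵇ-true i<j))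
... | inj₂ j≤i = trans (<ᵇ-false (punchIn-mono-≤ c j i j≤i)) (sym (<ᵇ-false j≤i))

sum-cardPerm : ∀ {b} (c : Fin b) (f : Fin b → ℕ) → sum (f ∘ cardPerm c) ≡ sum f
sum-cardPerm {suc b} c f =
  trans (cong (f c +_) (sum-cong-≗ (cong f ∘ cardPerm-suc c))) (sym (sum-remove {i = c} f))

-- Words of thrown balls.

module _ {b : ℕ} where

  perm-injective : ∀ (A : List (Fin b)) {i j} → perm A i ≡ perm A j → i ≡ j
  perm-injective []      eq = eq
  perm-injective (c ∷ A) eq = cardPerm-injective c (perm-injective A eq)

  sum-perm : ∀ (A : List (Fin b)) (f : Fin b → ℕ) → sum (f ∘ perm A) ≡ sum f
  sum-perm []      f = refl
  sum-perm (c ∷ A) f = trans (sum-cardPerm c (f ∘ perm A)) (sum-perm A f)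

  -- perm A c is the ball at the bottom level before card c, named by its level after all cards.
  throws : List (Fin b) → List (Fin b)
  throws []      = []
  throws (c ∷ A) = perm A c ∷ throws A

  -- precedes (throws A) u z says that u is below z at the start of A; the letters not thrown are in
  -- increasing order.
  precedes : List (Fin b) → Fin b → Fin b → Bool
  precedes []      u z = toℕ u <ᵇ toℕ z
  precedes (x ∷ w) u z = if does (x ≟ z) then false else if does (x ≟ u) then true else precedes w u z

  ΣW-sum : ∀ n {k} (f : Fin k → List (Fin b) → ℕ) →
           ΣW n (λ w → sum (λ i → f i w)) ≡ sum (λ i → ΣW n (f i))
  ΣW-sum zero    f = refl
  ΣW-sum (suc n) f =
    trans (sum-cong-≗ (λ x → ΣW-sum n (λ i w → f i (x ∷ w)))) (∑-comm (λ x i → ΣW n (λ w → f i (x ∷ w))))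

  -- For a fixed tail `A`, the letter `perm A c` runs over all letters as `c` does, since `perm A`
  -- is a permutation. Thus no inverse of `throws` has to be built.
  ΣW-throws : ∀ n (f : List (Fin b) → ℕ) → ΣW n (f ∘ throws) ≡ ΣW n f
  ΣW-throws zero    f = refl
  ΣW-throws (suc n) f = begin
    sum (λ c → ΣW n (λ A → f (perm A c ∷ throws A)))
      ≡⟨ ΣW-sum n (λ c A → f (perm A c ∷ throws A)) ⟨
    ΣW n (λ A → sum (λ c → f (perm A c ∷ throws A)))
      ≡⟨ ΣW-cong n (λ A → sum-perm A (λ x → f (x ∷ throws A))) ⟩
    ΣW n (λ A → sum (λ x → f (x ∷ throws A)))
      ≡⟨ ΣW-throws n (λ w → sum (λ x → f (x ∷ w))) ⟩
    ΣW n (λ w → sum (λ x → f (x ∷ w)))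
      ≡⟨ ΣW-sum n (λ x w → f (x ∷ w)) ⟩
    sum (λ x → ΣW n (λ w → f (x ∷ w))) ∎

  length-filter-map : ∀ {P : List (Fin b) → Set} (P? : Decidable P) c L →
    length (filter P? (map (c ∷_) L)) ≡ length (filter (λ w → P? (c ∷ w)) L)
  length-filter-map P? c []      = refl
  length-filter-map P? c (w ∷ L) with does (P? (c ∷ w))
  ... | true  = cong suc (length-filter-map P? c L)
  ... | false = length-filter-map P? c L

  length-filter-concatMap : ∀ {P : List (Fin b) → Set} (P? : Decidable P)
    (K : Fin b → List (List (Fin b))) {k} (h : Fin k → Fin b) →
    length (filter P? (concatMap K (tabulate h))) ≡ sum (λ i → length (filter P? (K (h i))))
  length-filter-concatMap P? K {zero}  h = refl
  length-filter-concatMap P? K {suc k} h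
    rewrite filter-++ P? (K (h zero)) (concatMap K (tabulate (h ∘ suc)))
          | length-++ (filter P? (K (h zero))) {filter P? (concatMap K (tabulate (h ∘ suc)))}
    = cong (length (filter P? (K (h zero))) +_) (length-filter-concatMap P? K (h ∘ suc))

  length-filter-seqs : ∀ {P : List (Fin b) → Set} (P? : Decidable P) n →
    length (filter P? (seqs b n)) ≡ ΣW n (λ w → 𝟙 (does (P? w)))
  length-filter-seqs P? zero with does (P? [])
  ... | true  = refl
  ... | false = refl
  length-filter-seqs P? (suc n) =
    trans (length-filter-concatMap P? (λ c → map (c ∷_) (seqs b n)) (λ c → c))
      (sum-cong-≗ (λ c → trans (length-filter-map P? c (seqs b n))
                               (length-filter-seqs (λ w → P? (c ∷ w)) n)))

  precedes-irrefl : ∀ w u → precedes w u u ≡ false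
  precedes-irrefl []      u = <ᵇ-false (≤-refl {toℕ u})
  precedes-irrefl (x ∷ w) u with x ≟ u
  ... | yes _ = refl
  ... | no _  = precedes-irrefl w u

  precedes-asym : ∀ w u z → precedes w u z ≡ true → precedes w z u ≡ false
  precedes-asym []      u z eq = <ᵇ-false (<⇒≤ (true-<ᵇ {toℕ u} eq))
  precedes-asym (x ∷ w) u z eq with x ≟ z
  ... | no _ with x ≟ u
  ...   | yes _ = refl
  ...   | no _  = precedes-asym w u z eq

-- The first card throws the ball on the bottom level, which precedes all others; the rest keep
-- their order, and induction applies to them on their new levels.
precedes-perm : ∀ {b} (A : List (Fin b)) i j → precedes (throws A) (perm A i) (perm A j) ≡
  (toℕ i <ᵇ toℕ j)
precedes-perm []      i j = refl
precedes-perm (c ∷ A) i zero rewrite dec-true (perm A c ≟ perm A c) refl = refl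
precedes-perm (c ∷ A) zero (suc j)
  rewrite dec-false (perm A c ≟ perm (c ∷ A) (suc j))
            (λ eq → contradiction (perm-injective (c ∷ A) {zero} {suc j} eq) λ ())
        | dec-true (perm A c ≟ perm A c) refl = refl
precedes-perm (c ∷ A) (suc i) (suc j)
  rewrite dec-false (perm A c ≟ perm (c ∷ A) (suc j))
            (λ eq → contradiction (perm-injective (c ∷ A) {zero} {suc j} eq) λ ())
        | dec-false (perm A c ≟ perm (c ∷ A) (suc i))
            (λ eq → contradiction (perm-injective (c ∷ A) {zero} {suc i} eq) λ ())
  = trans (precedes-perm A (cardPerm c (suc i)) (cardPerm c (suc j))) (cardPerm-<ᵇ c i j)

-- Crossings of pairs of letters.

module _ {b : ℕ} where

  ∑₂ : (Fin b → Fin b → ℕ) → ℕ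
  ∑₂ f = sum (λ z → sum (λ u → f u z))

  ∑₂-cong : ∀ {f g} → (∀ u z → f u z ≡ g u z) → ∑₂ f ≡ ∑₂ g
  ∑₂-cong eq = sum-cong-≗ (λ z → sum-cong-≗ (λ u → eq u z))

  ∑₂-+ : ∀ f g → ∑₂ (λ u z → f u z + g u z) ≡ ∑₂ f + ∑₂ g
  ∑₂-+ f g = trans (sum-cong-≗ (λ z → ∑-distrib-+ (λ u → f u z) (λ u → g u z)))
                   (∑-distrib-+ (λ z → sum (λ u → f u z)) (λ z → sum (λ u → g u z)))

  ∑₂-δ : ∀ x (f : Fin b → Fin b → ℕ → ℕ) → (∀ u z → f u z 0 ≡ 0) → (t : Fin b → Fin b → ℕ) →
         ∑₂ (λ u z → f u z (if does (x ≟ z) then t u z else 0)) ≡ sum (λ u → f u x (t u x))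
  ∑₂-δ x f f0 t = trans (sum-cong-≗ pull) (sum-δ x (sum (λ u → f u x (t u x))))
    where
    pull : ∀ z → sum (λ u → f u z (if does (x ≟ z) then t u z else 0)) ≡
                 (if does (x ≟ z) then sum (λ u → f u x (t u x)) else 0)
    pull z with x ≟ z
    ... | yes refl = refl
    ... | no _     = trans (sum-cong-≗ (λ u → f0 u z)) (sum-replicate-zero b)

  -- The throws of `z` that pass `u`: the thrown ball starts at the bottom, so it passes exactly the
  -- balls that lie below it afterwards.
  crossings : List (Fin b) → Fin b → Fin b → ℕ
  crossings []      u z = 0
  crossings (x ∷ w) u z = (if does (x ≟ z) then 𝟙 (precedes w u z) else 0) + crossings w u z

  crossings-diag : ∀ w u → crossings w u u ≡ 0
  crossings-diag []      u = refl
  crossings-diag (x ∷ w) u rewrite precedes-irrefl w u | crossings-diag w u with x ≟ u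
  ... | yes _ = refl
  ... | no _  = refl

  -- `toℕ c` counts the levels below the landing level, and `perm A` renames them to the balls
  -- passed.
  Cr-crossings : ∀ A → Cr A ≡ ∑₂ (crossings (throws A))
  Cr-crossings [] = sym (trans (sum-cong-≗ {b} (λ _ → sum-replicate-zero b)) (sum-replicate-zero b))
  Cr-crossings (c ∷ A) = begin
    toℕ c + Cr A
      ≡⟨ cong₂ _+_ (sym (sum-< c)) (Cr-crossings A) ⟩
    sum (λ (i : Fin b) → 𝟙 (toℕ i <ᵇ toℕ c)) + ∑₂ (crossings w)
      ≡⟨ cong (_+ ∑₂ (crossings w)) (sum-cong-≗ (λ i → cong 𝟙 (sym (precedes-perm A i c)))) ⟩
    sum (λ i → 𝟙 (precedes w (perm A i) (perm A c))) + ∑₂ (crossings w)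
      ≡⟨ cong (_+ ∑₂ (crossings w)) (sum-perm A (λ u → 𝟙 (precedes w u (perm A c)))) ⟩
    sum (λ u → 𝟙 (precedes w u (perm A c))) + ∑₂ (crossings w)
      ≡⟨ cong (_+ ∑₂ (crossings w)) (∑₂-δ (perm A c) (λ _ _ n → n) (λ _ _ → refl) (λ u z → 𝟙 (precedes w u z))) ⟨
    ∑₂ (λ u z → if does (perm A c ≟ z) then 𝟙 (precedes w u z) else 0) + ∑₂ (crossings w)
      ≡⟨ ∑₂-+ _ (crossings w) ⟨
    ∑₂ (crossings (perm A c ∷ w)) ∎
    where w = throws A

  -- What a prefix tells about a pair u < z: z has not occurred (fresh), or both have and the last of
  -- the two to occur was u (lowLast) or z (highLast).
  data Phase : Set where
    fresh lowLast highLast : Phase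

  lowAgain : Phase → Phase
  lowAgain fresh    = fresh
  lowAgain lowLast  = lowLast
  lowAgain highLast = lowLast

  step : Fin b → Fin b → Phase → Fin b → Phase
  step u z s x = if does (x ≟ z) then highLast else if does (x ≟ u) then lowAgain s else s

  -- For u < z, `base` counts the changes of letter still forced in the restriction to the pair when
  -- a final `u` closes it up: to `z` and back, none, or only back.
  gain base : Phase → ℕ
  gain fresh    = 0
  gain lowLast  = 1
  gain highLast = 0
  base fresh    = 2
  base lowLast  = 0
  base highLast = 1

  -- The change between the last letter of the pair already read and the next one; `fresh` is
  -- treated as if `u` had just been read.
  owed : Phase → List (Fin b) → Fin b → Fin b → ℕ
  owed fresh    w u z = 𝟙 (precedes w z u)
  owed lowLast  w u z = 𝟙 (precedes w z u)
  owed highLast w u z = 𝟙 (precedes w u z)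

  pairExcess : Phase → List (Fin b) → Fin b → Fin b → ℕ
  pairExcess s []      u z = 0
  pairExcess s (x ∷ w) u z = (if does (x ≟ z) then gain s else 0) + pairExcess (step u z s x) w u z

  -- Changes to `z` and back to `u` alternate, so each return to `z` costs two; `owed` supplies the
  -- change across the cut between prefix and `w`. In phase `fresh` the value 2 of `base` is right
  -- only if `z` still occurs.
  pair-crossings : ∀ w s u z → toℕ u < toℕ z → (s ≡ fresh → mem w z ≡ true) →
         owed s w u z + (crossings w u z + crossings w z u) ≡ 2 * pairExcess s w u z + base s
  pair-crossings []      fresh    u z u<z occ = contradiction (occ refl) λ ()
  pair-crossings []      lowLast  u z u<z occ rewrite <ᵇ-false (<⇒≤ u<z) = refl
  pair-crossings []      highLast u z u<z occ rewrite <ᵇ-true u<z = refl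
  pair-crossings (x ∷ w) s u z u<z occ with x ≟ z
  pair-crossings (x ∷ w) s u z u<z occ | yes refl with x ≟ u
  pair-crossings (x ∷ w) s u z u<z occ | yes refl | yes refl = contradiction u<z (<-irrefl refl)
  pair-crossings (x ∷ w) s u z u<z occ | yes refl | no _ =
    trans (cong (_+ (𝟙 (precedes w u x) + crossings w u x + crossings w x u)) (owed≡ s))
      (trans (lem₁ (h s) (𝟙 (precedes w u x)) (crossings w u x) (crossings w x u))
        (trans (cong (h s +_) (pair-crossings w highLast u x u<z λ ()))
          (lem₂ s (pairExcess highLast w u x))))
    where
    h : Phase → ℕ
    h fresh    = 1
    h lowLast  = 1
    h highLast = 0
    owed≡ : ∀ s → owed s (x ∷ w) u x ≡ h s
    owed≡ fresh    rewrite dec-true (x ≟ x) refl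
                           | dec-false (x ≟ u) (λ { refl → <-irrefl refl u<z }) = refl
    owed≡ lowLast  rewrite dec-true (x ≟ x) refl
                           | dec-false (x ≟ u) (λ { refl → <-irrefl refl u<z }) = refl
    owed≡ highLast rewrite dec-true (x ≟ x) refl = refl
    lem₁ : ∀ h l p q → h + (l + p + q) ≡ h + (l + (p + q))
    lem₁ = solve-∀
    f₁ : ∀ e → 1 + (2 * e + 1) ≡ 2 * (0 + e) + 2
    f₁ = solve-∀
    f₂ : ∀ e → 1 + (2 * e + 1) ≡ 2 * (1 + e) + 0
    f₂ = solve-∀
    lem₂ : ∀ s e → h s + (2 * e + 1) ≡ 2 * (gain s + e) + base s
    lem₂ fresh    = f₁
    lem₂ lowLast  = f₂
    lem₂ highLast = λ _ → refl
  pair-crossings (x ∷ w) s u z u<z occ | no x≢z with x ≟ u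
  pair-crossings (x ∷ w) s u z u<z occ | no x≢z | yes refl = go s occ
    where
    move : ∀ c k d → c + (k + d) ≡ k + (c + d)
    move = solve-∀
    go : ∀ s → (s ≡ fresh → mem w z ≡ true) →
         owed s (x ∷ w) x z + (crossings w x z + (𝟙 (precedes w z x) + crossings w z x)) ≡
         2 * pairExcess (lowAgain s) w x z + base s
    go fresh occ rewrite dec-true (x ≟ x) refl =
      trans (move (crossings w x z) (𝟙 (precedes w z x)) (crossings w z x)) (pair-crossings w fresh x z u<z occ)
    go lowLast occ rewrite dec-true (x ≟ x) refl =
      trans (move (crossings w x z) (𝟙 (precedes w z x)) (crossings w z x)) (pair-crossings w lowLast x z u<z λ ())
    go highLast occ rewrite dec-false (x ≟ z) x≢z | dec-true (x ≟ x) refl =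
      trans (cong suc (trans (move (crossings w x z) (𝟙 (precedes w z x)) (crossings w z x))
                       (pair-crossings w lowLast x z u<z λ ())))
            (lem (pairExcess lowLast w x z))
      where
      lem : ∀ e → 1 + (2 * e + 0) ≡ 2 * e + 1
      lem = solve-∀
  pair-crossings (x ∷ w) s u z u<z occ | no x≢z | no x≢u =
    trans (cong (_+ (crossings w u z + crossings w z u)) (owed≡ s)) (pair-crossings w s u z u<z occ)
    where
    owed≡ : ∀ s → owed s (x ∷ w) u z ≡ owed s w u z
    owed≡ fresh    rewrite dec-false (x ≟ z) x≢z | dec-false (x ≟ u) x≢u = refl
    owed≡ lowLast  rewrite dec-false (x ≟ z) x≢z | dec-false (x ≟ u) x≢u = refl
    owed≡ highLast rewrite dec-false (x ≟ z) x≢z | dec-false (x ≟ u) x≢u = refl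

  -- Phases read off the list of seen letters.

  after : List (Fin b) → Fin b → Fin b → Bool
  after []      u z = false
  after (o ∷ l) u z = if does (o ≟ z) then mem l u else after l u z

  after-∉ : ∀ l u z → mem l z ≡ false → after l u z ≡ false
  after-∉ []      u z _  = refl
  after-∉ (o ∷ l) u z z∉ with o ≟ z
  ... | no _ = after-∉ l u z z∉

  after-snoc : ∀ l x u z → mem l x ≡ false →
    after (l ∷ʳ x) u z ≡ (if does (x ≟ z) then false else if does (x ≟ u) then mem l z else after l u z)
  after-snoc []      x u z _ with x ≟ z
  ... | yes _ = refl
  ... | no _ with x ≟ u
  ...   | yes _ = refl
  ...   | no _  = refl
  after-snoc (o ∷ l) x u z x∉ with o ≟ x
  ... | no o≢x with o ≟ z
  ...   | no _ = after-snoc l x u z x∉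
  ...   | yes refl rewrite dec-false (x ≟ o) (o≢x ∘ sym) | mem-snoc l x u with x ≟ u
  ...     | yes _ = refl
  ...     | no _  = refl

  after-moveToEnd : ∀ l x u z → Unique l →
    after (moveToEnd x l) u z ≡ (if does (x ≟ z) then false else if does (x ≟ u) then mem l z else after l u z)
  after-moveToEnd []      x u z _ = after-snoc [] x u z refl
  after-moveToEnd (o ∷ l) x u z (o∉ , uq) with o ≟ x
  ... | yes refl rewrite after-snoc l x u z o∉ with x ≟ z
  ...   | yes _ = refl
  ...   | no _  = refl
  after-moveToEnd (o ∷ l) x u z (o∉ , uq) | no o≢x with o ≟ z
  ...   | no _ = after-moveToEnd l x u z uq
  ...   | yes refl rewrite dec-false (x ≟ o) (o≢x ∘ sym) | mem-moveToEnd x l u with x ≟ u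
  ...     | yes _ = refl
  ...     | no _  = refl

  phaseOf : Bool → Bool → Phase
  phaseOf false _     = fresh
  phaseOf true  true  = lowLast
  phaseOf true  false = highLast

  phase : List (Fin b) → Fin b → Fin b → Phase
  phase l u z = phaseOf (mem l z) (after l u z)

  phase-moveToEnd : ∀ l x u z → Unique l → phase (moveToEnd x l) u z ≡ step u z (phase l u z) x
  phase-moveToEnd l x u z uq rewrite mem-moveToEnd x l z | after-moveToEnd l x u z uq with x ≟ z
  ... | yes _ = refl
  ... | no _ with x ≟ u
  ...   | no _ = refl
  ...   | yes _ with mem l z | after l u z
  ...     | false | _     = refl
  ...     | true  | true  = refl
  ...     | true  | false = refl

  gain-phase : ∀ l u z → gain (phase l u z) ≡ 𝟙 (after l u z)
  gain-phase l u z with mem l z in z∈ | after l u z in β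
  ... | true  | true  = refl
  ... | true  | false = refl
  ... | false | true  = contradiction (trans (sym β) (after-∉ l u z z∈)) λ ()
  ... | false | false = refl

  below : Fin b → Fin b → ℕ
  below u z = 𝟙 (toℕ u <ᵇ toℕ z)

  lower-sum : ∀ l x → Unique l → mem l x ≡ false → lower x l ≡ sum (λ u → below u x * 𝟙 (mem l u))
  lower-sum []      x _ _ = sym (trans (sum-cong-≗ (λ u → *-zeroʳ (below u x))) (sum-replicate-zero b))
  lower-sum (p ∷ l) x (p∉ , uq) x∉ with p ≟ x
  ... | no p≢x = begin
    𝟙 (leq p x) + lower x l
      ≡⟨ cong₂ _+_ (cong 𝟙 leq≡) (lower-sum l x uq x∉) ⟩
    below p x + sum (λ u → below u x * 𝟙 (mem l u))
      ≡⟨ sum-if p (below p x) (λ u → below u x * 𝟙 (mem l u))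
           (trans (cong (λ c → below p x * 𝟙 c) p∉) (*-zeroʳ (below p x))) ⟨
    sum (λ u → if does (p ≟ u) then below p x else below u x * 𝟙 (mem l u))
      ≡⟨ sum-cong-≗ merge ⟩
    sum (λ u → below u x * 𝟙 (mem (p ∷ l) u)) ∎
    where
    leq≡ : leq p x ≡ (toℕ p <ᵇ toℕ x)
    leq≡ with <-≤-connex (toℕ p) (toℕ x)
    ... | inj₁ p<x = trans (<ᵇ-true (m<n⇒m<1+n p<x)) (sym (<ᵇ-true p<x))
    ... | inj₂ x≤p = trans (<ᵇ-false (≤∧≢⇒< x≤p (p≢x ∘ sym ∘ toℕ-injective))) (sym (<ᵇ-false x≤p))
    merge : ∀ u → (if does (p ≟ u) then below p x else below u x * 𝟙 (mem l u)) ≡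
                  below u x * 𝟙 (mem (p ∷ l) u)
    merge u with p ≟ u
    ... | yes refl = sym (*-identityʳ (below p x))
    ... | no _     = refl

  excessAt-sum : ∀ l x → Unique l → excessAt l x ≡ sum (λ u → below u x * 𝟙 (after l u x))
  excessAt-sum []      x _ = sym (trans (sum-cong-≗ (λ u → *-zeroʳ (below u x))) (sum-replicate-zero b))
  excessAt-sum (o ∷ l) x (o∉ , uq) with o ≟ x
  ... | yes refl = lower-sum l x uq o∉
  ... | no _     = excessAt-sum l x uq

  -- Double counting: reading `z` adds one for each smaller `u` more recent than `z`, and these are
  -- the pairs in phase `lowLast`.
  excess-pairExcess : ∀ w l → Unique l → excess l w ≡ ∑₂ (λ u z → below u z * pairExcess (phase l u z) w u z)
  excess-pairExcess []      l uq = sym (trans (∑₂-cong (λ u z → *-zeroʳ (below u z)))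
    (trans (sum-cong-≗ {b} (λ _ → sum-replicate-zero b)) (sum-replicate-zero b)))
  excess-pairExcess (x ∷ w) l uq = begin
    excessAt l x + excess (moveToEnd x l) w
      ≡⟨ cong₂ _+_ (excessAt-sum l x uq) (excess-pairExcess w (moveToEnd x l) (Unique-moveToEnd x l uq)) ⟩
    sum (λ u → below u x * 𝟙 (after l u x)) + ∑₂ rest
      ≡⟨ cong (_+ ∑₂ rest) (∑₂-δ x (λ u z n → below u z * n) (λ u z → *-zeroʳ (below u z))
                                 (λ u z → 𝟙 (after l u z))) ⟨
    ∑₂ (λ u z → below u z * (if does (x ≟ z) then 𝟙 (after l u z) else 0)) + ∑₂ rest
      ≡⟨ ∑₂-+ _ rest ⟨
    ∑₂ (λ u z → below u z * (if does (x ≟ z) then 𝟙 (after l u z) else 0) + rest u z)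
      ≡⟨ ∑₂-cong merge ⟩
    ∑₂ (λ u z → below u z * pairExcess (phase l u z) (x ∷ w) u z) ∎
    where
    rest : Fin b → Fin b → ℕ
    rest u z = below u z * pairExcess (phase (moveToEnd x l) u z) w u z
    merge : ∀ u z → below u z * (if does (x ≟ z) then 𝟙 (after l u z) else 0) + rest u z ≡
                    below u z * pairExcess (phase l u z) (x ∷ w) u z
    merge u z rewrite phase-moveToEnd l x u z uq | gain-phase l u z = sym (*-distribˡ-+ (below u z) _ _)

  -- The crossing number in terms of the excess.

  ∑₂-sym : ∀ f → (∀ u → f u u ≡ 0) → ∑₂ f ≡ ∑₂ (λ u z → below u z * (f u z + f z u))
  ∑₂-sym f diag = begin
    ∑₂ f
      ≡⟨ ∑₂-cong split ⟩
    ∑₂ (λ u z → below u z * f u z + below z u * f u z)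
      ≡⟨ ∑₂-+ _ _ ⟩
    ∑₂ (λ u z → below u z * f u z) + ∑₂ (λ u z → below z u * f u z)
      ≡⟨ cong (∑₂ (λ u z → below u z * f u z) +_) (∑-comm (λ z u → below z u * f u z)) ⟩
    ∑₂ (λ u z → below u z * f u z) + ∑₂ (λ u z → below u z * f z u)
      ≡⟨ ∑₂-+ _ _ ⟨
    ∑₂ (λ u z → below u z * f u z + below u z * f z u)
      ≡⟨ ∑₂-cong (λ u z → *-distribˡ-+ (below u z) (f u z) (f z u)) ⟨
    ∑₂ (λ u z → below u z * (f u z + f z u)) ∎
    where
    split : ∀ u z → f u z ≡ below u z * f u z + below z u * f u z
    split u z with <-cmp (toℕ u) (toℕ z)
    ... | tri< u<z _ _ rewrite <ᵇ-true u<z | <ᵇ-false (<⇒≤ u<z) = lem (f u z)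
      where
      lem : ∀ n → n ≡ n + 0 + 0
      lem = solve-∀
    ... | tri> _ _ z<u rewrite <ᵇ-true z<u | <ᵇ-false (<⇒≤ z<u) = sym (+-identityʳ (f u z))
    ... | tri≈ _ u≡z _ rewrite toℕ-injective u≡z | diag z =
      sym (cong₂ _+_ (*-zeroʳ (below z z)) (*-zeroʳ (below z z)))

  -- Balls are named by their final level, so for a word of throws this says that the initial order
  -- equals the final one.
  Increasing : List (Fin b) → Set
  Increasing w = ∀ u z → toℕ u < toℕ z → precedes w u z ≡ true

  -- Sum `pair-crossings` over all pairs u < z, starting in phase `fresh`: the values of `base` add
  -- up to b(b - 1).
  Cr-excess : ∀ A → Increasing (throws A) → (∀ z → mem (throws A) z ≡ true) →
         Cr A ≡ b * (b ∸ 1) + 2 * excess [] (throws A)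
  Cr-excess A incr occ = begin
    Cr A
      ≡⟨ Cr-crossings A ⟩
    ∑₂ (crossings w)
      ≡⟨ ∑₂-sym (crossings w) (crossings-diag w) ⟩
    ∑₂ (λ u z → below u z * (crossings w u z + crossings w z u))
      ≡⟨ ∑₂-cong eval ⟩
    ∑₂ (λ u z → 2 * below u z + 2 * e u z)
      ≡⟨ ∑₂-+ (λ u z → 2 * below u z) (λ u z → 2 * e u z) ⟩
    ∑₂ (λ u z → 2 * below u z) + ∑₂ (λ u z → 2 * e u z)
      ≡⟨ cong₂ _+_ (∑₂-2* below) (∑₂-2* e) ⟩
    2 * ∑₂ below + 2 * ∑₂ e
      ≡⟨ cong₂ (λ y y′ → 2 * y + 2 * y′) (sum-cong-≗ {b} (λ z → sum-< z)) (sym (excess-pairExcess w [] tt)) ⟩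
    2 * sum {b} toℕ + 2 * excess [] w
      ≡⟨ cong (_+ 2 * excess [] w) (sum-toℕ b) ⟩
    b * (b ∸ 1) + 2 * excess [] w ∎
    where
    w = throws A
    e : Fin b → Fin b → ℕ
    e u z = below u z * pairExcess fresh w u z
    ∑₂-2* : ∀ f → ∑₂ (λ u z → 2 * f u z) ≡ 2 * ∑₂ f
    ∑₂-2* f = sym (trans (*-distribˡ-sum 2 (λ z → sum (λ u → f u z)))
                         (sum-cong-≗ (λ z → *-distribˡ-sum 2 (λ u → f u z))))
    lem : ∀ p → 1 * (2 * p + 2) ≡ 2 * 1 + 2 * (1 * p)
    lem = solve-∀
    eval : ∀ u z → below u z * (crossings w u z + crossings w z u) ≡ 2 * below u z + 2 * e u z
    eval u z with <-≤-connex (toℕ u) (toℕ z)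
    ... | inj₂ z≤u rewrite <ᵇ-false z≤u = refl
    ... | inj₁ u<z rewrite <ᵇ-true u<z =
      trans (cong (1 *_) (trans
        -- The term `owed` vanishes initially, because `u` precedes `z`.
        (cong (λ c → 𝟙 c + (crossings w u z + crossings w z u)) (sym (precedes-asym w u z (incr u z u<z))))
                                (pair-crossings w fresh u z u<z (λ _ → occ z))))
            (lem (pairExcess fresh w u z))

  -- Restricted growth and the identity permutation.

  restrictedGrowth-tail : ∀ {m} {x : Fin b} {w} → restrictedGrowth m (x ∷ w) ≡ true → {P : Set} →
    (toℕ x < m → restrictedGrowth m w ≡ true → P) → (toℕ x ≡ m → restrictedGrowth (suc m) w ≡ true → P) → P
  restrictedGrowth-tail {m} {x} eq old new with <-cmp (toℕ x) m
  ... | tri< x<m _ _ rewrite <ᵇ-true x<m = old x<m eq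
  ... | tri≈ _ x≡m _ rewrite <ᵇ-false (≤-reflexive (sym x≡m)) | x≡m | ≡ᵇ-refl m = new refl eq
  ... | tri> _ x≢m m<x rewrite <ᵇ-false (<⇒≤ m<x) | ≡ᵇ-false x≢m = contradiction eq λ ()

  restrictedGrowth-mem : ∀ m w → restrictedGrowth m w ≡ true → ∀ z → m ≤ toℕ z → mem w z ≡ true
  restrictedGrowth-mem m [] eq z m≤z = contradiction (toℕ<n z)
    (≤⇒≯ (subst (_≤ toℕ z) (≡ᵇ⇒≡ m b (subst T (sym eq) tt)) m≤z))
  restrictedGrowth-mem m (x ∷ w) eq z m≤z with x ≟ z
  ... | yes _  = refl
  ... | no x≢z = restrictedGrowth-tail {m} {x} {w} eq
    (λ _ eq′ → restrictedGrowth-mem m w eq′ z m≤z)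
    (λ x≡m eq′ → restrictedGrowth-mem (suc m) w eq′ z
      (≤∧≢⇒< m≤z (λ m≡z → x≢z (toℕ-injective (trans x≡m m≡z)))))

  restrictedGrowth-precedes : ∀ m w → restrictedGrowth m w ≡ true → ∀ u z →
    m ≤ toℕ u → toℕ u < toℕ z → precedes w u z ≡ true
  restrictedGrowth-precedes m []      eq u z m≤u u<z = <ᵇ-true u<z
  restrictedGrowth-precedes m (x ∷ w) eq u z m≤u u<z = restrictedGrowth-tail {m} {x} {w} eq old new
    where
    old : toℕ x < m → restrictedGrowth m w ≡ true → precedes (x ∷ w) u z ≡ true
    old x<m eq′ with x ≟ z
    ... | yes refl = contradiction x<m (≤⇒≯ (≤-trans m≤u (<⇒≤ u<z)))
    ... | no _ with x ≟ u
    ...   | yes _ = refl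
    ...   | no _  = restrictedGrowth-precedes m w eq′ u z m≤u u<z
    new : toℕ x ≡ m → restrictedGrowth (suc m) w ≡ true → precedes (x ∷ w) u z ≡ true
    new x≡m eq′ with x ≟ z
    ... | yes refl = contradiction u<z (≤⇒≯ (subst (_≤ toℕ u) (sym x≡m) m≤u))
    ... | no _ with x ≟ u
    ...   | yes _  = refl
    ...   | no x≢u = restrictedGrowth-precedes (suc m) w eq′ u z
                   (≤∧≢⇒< m≤u (λ m≡u → x≢u (toℕ-injective (trans x≡m m≡u)))) u<z

  IsId⇒Increasing : ∀ A → IsId A → Increasing (throws A)
  IsId⇒Increasing A id u z u<z =
    trans (cong₂ (precedes (throws A)) (sym (id u)) (sym (id z))) (trans (precedes-perm A u z) (<ᵇ-true u<z))

  -- Count the balls that precede `perm A j`: by their names there are `toℕ (perm A j)`, by their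
  -- initial levels `toℕ j`.
  Increasing⇒IsId : ∀ A → Increasing (throws A) → IsId A
  Increasing⇒IsId A incr j = toℕ-injective (begin
    toℕ (perm A j)
      ≡⟨ sum-< (perm A j) ⟨
    sum (λ (u : Fin b) → 𝟙 (toℕ u <ᵇ toℕ (perm A j)))
      ≡⟨ sum-cong-≗ (λ u → cong 𝟙 (lt≡<ᵇ u (perm A j))) ⟨
    sum (λ u → 𝟙 (precedes (throws A) u (perm A j)))
      ≡⟨ sum-perm A (λ u → 𝟙 (precedes (throws A) u (perm A j))) ⟨
    sum (λ i → 𝟙 (precedes (throws A) (perm A i) (perm A j)))
      ≡⟨ sum-cong-≗ (λ i → cong 𝟙 (precedes-perm A i j)) ⟩
    sum (λ (i : Fin b) → 𝟙 (toℕ i <ᵇ toℕ j))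
      ≡⟨ sum-< j ⟩
    toℕ j ∎)
    where
    lt≡<ᵇ : ∀ u z → precedes (throws A) u z ≡ (toℕ u <ᵇ toℕ z)
    lt≡<ᵇ u z with <-cmp (toℕ u) (toℕ z)
    ... | tri< u<z _ _ = trans (incr u z u<z) (sym (<ᵇ-true u<z))
    ... | tri≈ _ u≡z _ rewrite toℕ-injective u≡z =
      trans (precedes-irrefl (throws A) z) (sym (<ᵇ-false (≤-refl {toℕ z})))
    ... | tri> _ _ z<u = trans (precedes-asym (throws A) z u (incr z u z<u)) (sym (<ᵇ-false (<⇒≤ z<u)))

-- The top card and the translation of the conditions.

module _ {b : ℕ} where

  top : Fin (suc b)
  top = fromℕ b

  ≢top⇒< : ∀ {x : Fin (suc b)} → x ≢ top → toℕ x < toℕ top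
  ≢top⇒< {x} x≢ = ≤∧≢⇒< (subst (toℕ x ≤_) (sym (toℕ-fromℕ b)) (toℕ≤pred[n] x)) (x≢ ∘ toℕ-injective)

  -- Induction from the last card: once the tail fixes the top level, a top card in front of it
  -- would throw the very ball that ends on top.
  top-unthrown : ∀ A → mem (throws A) top ≡ false → perm A top ≡ top × ¬ UsesTop A
  top-unthrown []      _  = refl , λ ()
  top-unthrown (c ∷ A) t∉ with perm A c ≟ top
  ... | no Ac≢ with top-unthrown A t∉
  ...   | fix , none = trans (cong (perm A) (cardPerm-above c top (≢top⇒< c≢))) fix , λ where
            (here c≡)  → c≢ (toℕ-injective (trans (suc-injective c≡) (sym (toℕ-fromℕ b))))
            (there ut) → none ut
    where
    c≢ : c ≢ top
    c≢ refl = Ac≢ fix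

  unused-top : ∀ A → ¬ UsesTop A → perm A top ≡ top × mem (throws A) top ≡ false
  unused-top []      _    = refl , refl
  unused-top (c ∷ A) none with unused-top A (none ∘ there)
  ... | fix , t∉ = trans (cong (perm A) (cardPerm-above c top (≢top⇒< c≢))) fix , t∉′
    where
    c≢ : c ≢ top
    c≢ refl = none (here (cong suc (toℕ-fromℕ b)))
    t∉′ : mem (throws (c ∷ A)) top ≡ false
    t∉′ rewrite dec-false (perm A c ≟ top) (λ eq → c≢ (perm-injective A (trans eq (sym fix)))) = t∉

  UsesTop⇒mem : ∀ A → UsesTop A → mem (throws A) top ≡ true
  UsesTop⇒mem A ut with mem (throws A) top in eq
  ... | true  = refl
  ... | false = contradiction ut (proj₂ (top-unthrown A eq))

  mem⇒UsesTop : ∀ A → mem (throws A) top ≡ true → UsesTop A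
  mem⇒UsesTop A t∈ with Any.any? (λ c → suc (toℕ c) ≟ℕ suc b) A
  ... | yes ut = ut
  ... | no ¬ut = contradiction (trans (sym t∈) (proj₂ (unused-top A ¬ut))) λ ()

  -- The order forbids skipping a letter, and the occurrence of `top` forces the number of seen
  -- letters up to the maximum.
  order-restrictedGrowth : ∀ m w → m ≤ suc b → (∀ u z → m ≤ toℕ u → toℕ u < toℕ z → precedes w u z ≡ true) →
             (m ≤ b → mem w top ≡ true) → restrictedGrowth m w ≡ true
  order-restrictedGrowth m [] m≤ incr occ with m ≟ℕ suc b
  ... | yes refl = ≡ᵇ-refl m
  ... | no m≢    = contradiction (occ (s≤s⁻¹ (≤∧≢⇒< m≤ m≢))) λ ()
  order-restrictedGrowth m (x ∷ w) m≤ incr occ with <-cmp (toℕ x) m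
  ... | tri< x<m _ _ rewrite <ᵇ-true x<m = order-restrictedGrowth m w m≤ incr′ occ′
    where
    incr′ : ∀ u z → m ≤ toℕ u → toℕ u < toℕ z → precedes w u z ≡ true
    incr′ u z m≤u u<z with x ≟ z | x ≟ u | incr u z m≤u u<z
    ... | yes refl | _        | _  = contradiction x<m (≤⇒≯ (≤-trans m≤u (<⇒≤ u<z)))
    ... | no _     | yes refl | _  = contradiction x<m (≤⇒≯ m≤u)
    ... | no _     | no _     | eq = eq
    occ′ : m ≤ b → mem w top ≡ true
    occ′ m≤b with x ≟ top | occ m≤b
    ... | yes refl | _  = contradiction x<m (≤⇒≯ (subst (m ≤_) (sym (toℕ-fromℕ b)) m≤b))
    ... | no _     | eq = eq
  ... | tri≈ _ refl _ rewrite <ᵇ-false (≤-refl {m}) | ≡ᵇ-refl m = order-restrictedGrowth (suc m) w (toℕ<n x) incr′ occ′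
    where
    incr′ : ∀ u z → m < toℕ u → toℕ u < toℕ z → precedes w u z ≡ true
    incr′ u z m<u u<z with x ≟ z | x ≟ u | incr u z (<⇒≤ m<u) u<z
    ... | yes refl | _        | _  = contradiction u<z (<⇒≱ m<u ∘ <⇒≤)
    ... | no _     | yes refl | _  = contradiction m<u (<-irrefl refl)
    ... | no _     | no _     | eq = eq
    occ′ : m < b → mem w top ≡ true
    occ′ m<b with x ≟ top | occ (<⇒≤ m<b)
    ... | yes refl | _  = contradiction (toℕ-fromℕ b) (<⇒≢ m<b)
    ... | no _     | eq = eq
  -- Reading `x` would skip the letter `y` with value `m`, which has to precede `x`.
  ... | tri> _ x≢m m<x =
    contradiction (trans (sym (incr y x (≤-reflexive (sym y≡m)) (subst (_< toℕ x) (sym y≡m) m<x))) first) λ ()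
    where
    m<1+b : m < suc b
    m<1+b = <-trans m<x (toℕ<n x)
    y = fromℕ< m<1+b
    y≡m : toℕ y ≡ m
    y≡m = toℕ-fromℕ< m<1+b
    first : precedes (x ∷ w) y x ≡ false
    first rewrite dec-true (x ≟ x) refl = refl

  -- Identity and use of the top card amount to restricted growth in all letters; `Cr-excess` then
  -- reduces the crossing condition to twice the excess being 2.
  Good≡accepts : ∀ A → 𝟙 (does (good? (suc b) A)) ≡ accepts 1 0 [] (throws A)
  Good≡accepts A = go (good? (suc b) A)
    where
    w = throws A
    forward : Good (suc b) A → restrictedGrowth 0 w ≡ true × excess [] w ≡ 1
    forward (id , ut , cr) = rg≡ , *-cancelˡ-≡ _ _ 2 (+-cancelˡ-≡ (suc b * b) _ _
      (trans (sym (Cr-excess A (IsId⇒Increasing A id) (λ z → restrictedGrowth-mem 0 w rg≡ z z≤n))) cr))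
      where
      rg≡ = order-restrictedGrowth 0 w z≤n (λ u z _ → IsId⇒Increasing A id u z) (λ _ → UsesTop⇒mem A ut)
    backward : restrictedGrowth 0 w ≡ true → excess [] w ≡ 1 → Good (suc b) A
    backward rg≡ E≡ = Increasing⇒IsId A incr , mem⇒UsesTop A (occ top) ,
      trans (Cr-excess A incr occ) (cong (λ e → suc b * b + 2 * e) E≡)
      where
      incr : Increasing w
      incr u z = restrictedGrowth-precedes 0 w rg≡ u z z≤n
      occ : ∀ z → mem w z ≡ true
      occ z = restrictedGrowth-mem 0 w rg≡ z z≤n
    go : (d : Dec (Good (suc b) A)) → 𝟙 (does d) ≡ accepts 1 0 [] w
    go (yes good) = let rg≡ , E≡ = forward good in
      sym (cong₂ (λ r e → 𝟙 (r ∧ (e ≡ᵇ 1))) rg≡ E≡)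
    go (no ¬good) with restrictedGrowth 0 w in rg≡
    ... | false = refl
    ... | true with excess [] w ≡ᵇ 1 in E≡
    ...   | false = refl
    ...   | true  = contradiction (backward rg≡ (≡ᵇ⇒≡ _ 1 (subst T (sym E≡) tt))) ¬good

theorem5p1 : (b n : ℕ) → 2 ≤ b → 1 ≤ n → g b n ≡ (n C (b + 2)) * (n C (b ∸ 2))
theorem5p1 (suc zero) n (s≤s ()) _
theorem5p1 (suc (suc b)) n _ _ = begin
  g (2 + b) n
    ≡⟨ length-filter-seqs (good? (2 + b)) n ⟩
  ΣW n (λ A → 𝟙 (does (good? (2 + b) A)))
    ≡⟨ ΣW-cong n Good≡accepts ⟩
  ΣW n (accepts 1 0 [] ∘ throws)
    ≡⟨ ΣW-throws n (accepts 1 0 []) ⟩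
  ΣW n (accepts 1 0 [])
    ≡⟨ count n ⟩
  -- `choose₂ n (2 + b)` reduces to `choose n b`.
  choose n b * choose n (2 + (2 + b))
    ≡⟨ *-comm (choose n b) _ ⟩
  choose n (2 + (2 + b)) * choose n b
    ≡⟨ cong₂ _*_ (choose≡C n (2 + (2 + b))) (choose≡C n b) ⟩
  (n C (2 + (2 + b))) * (n C b)
    ≡⟨ cong (λ k → (n C k) * (n C b)) (+-comm 2 (2 + b)) ⟩
  (n C (2 + b + 2)) * (n C b) ∎
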